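{- Let $E_{24}$ be the elliptic curve over the function field $\mathbb{Q}(a)$ given by $y^2 = x^3 + (4a-1)x^2 + 16a\,x + 64a^2 - 16a$. Then $E_{24}(\mathbb{Q}(a))$ has rank $0$ and torsion subgroup isomorphic to $\mathbb{Z}/4\mathbb{Z}$, generated by the point $(x,y) = (2, 8a+2)$.
   Context: $E_{24}$ is a Weierstrass model of the genus-one curve $V(s^2 - tz - (t^2-az^2),\, u^2 + tz - (t^2-az^2)) \subset \mathbb{P}^3_{\mathbb{Q}(a)}$ with coordinates $(s,t,u,z)$; its $j$-invariant is $(16a^2-56a+1)^3/(a(4a+1)^4)$ and discriminant $a(4a+1)^4$. -}

module Defs where

open import Data.Nat using (ℕ; zero; suc)
open import Data.Integer using (+_)
import Data.Rational as Q
open import Data.Rational using (ℚ; 0ℚ; 1ℚ)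
open import Data.Rational.Properties using () renaming (_≟_ to _≟ℚ_)
open import Data.List using (List; []; _∷_)
open import Data.List.Relation.Unary.All using (All; all?)
open import Data.Product using (_×_; _,_)
open import Data.Empty using (⊥)
open import Data.Unit using (⊤)
open import Relation.Binary.PropositionalEquality using (_≡_)
open import Relation.Nullary using (Dec; yes; no; ¬_)

-- Polynomials in a over ℚ : coefficient lists, lowest degree first.

Poly : Set
Poly = List ℚ

infixl 6 _+ₚ_
infixl 7 _*ₚ_

_+ₚ_ : Poly → Poly → Poly
[] +ₚ q = q
(c ∷ p) +ₚ [] = c ∷ p
(c ∷ p) +ₚ (d ∷ q) = (c Q.+ d) ∷ (p +ₚ q)

scaleₚ : ℚ → Poly → Poly
scaleₚ c [] = []
scaleₚ c (d ∷ p) = (c Q.* d) ∷ scaleₚ c p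

negₚ : Poly → Poly
negₚ = scaleₚ (Q.- 1ℚ)

_*ₚ_ : Poly → Poly → Poly
[] *ₚ q = []
(c ∷ p) *ₚ q = scaleₚ c q +ₚ (0ℚ ∷ (p *ₚ q))

IsZeroₚ : Poly → Set
IsZeroₚ p = All (_≡ 0ℚ) p

isZeroₚ? : (p : Poly) → Dec (IsZeroₚ p)
isZeroₚ? p = all? (λ c → c ≟ℚ 0ℚ) p

-- Elements of ℚ(a): fractions num/den of polynomials.  Denominators are
-- required to be nonzero (predicate `Valid`) wherever elements are
-- quantified over; equality is cross-multiplication.

record Fn : Set where
  constructor _//_
  field
    num : Poly
    den : Poly
open Fn public

Valid : Fn → Set
Valid f = ¬ IsZeroₚ (den f)

constF : ℚ → Fn
constF c = (c ∷ []) // (1ℚ ∷ [])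

nat : ℕ → Fn
nat n = constF (+ n Q./ 1)

varA : Fn
varA = (0ℚ ∷ 1ℚ ∷ []) // (1ℚ ∷ [])

infixl 6 _+F_ _-F_
infixl 7 _*F_
infix 4 _≈F_

_+F_ : Fn → Fn → Fn
(n₁ // d₁) +F (n₂ // d₂) = ((n₁ *ₚ d₂) +ₚ (n₂ *ₚ d₁)) // (d₁ *ₚ d₂)

negF : Fn → Fn
negF (n // d) = negₚ n // d

_-F_ : Fn → Fn → Fn
f -F g = f +F negF g

_*F_ : Fn → Fn → Fn
(n₁ // d₁) *F (n₂ // d₂) = (n₁ *ₚ n₂) // (d₁ *ₚ d₂)

-- multiplicative inverse (with the harmless convention 0⁻¹ = 0)
invF : Fn → Fn
invF (n // d) with isZeroₚ? n
... | yes _ = constF 0ℚ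
... | no  _ = d // n

_/F_ : Fn → Fn → Fn
f /F g = f *F invF g

_≈F_ : Fn → Fn → Set
f ≈F g = IsZeroₚ (num (f -F g))

_≈F?_ : (f g : Fn) → Dec (f ≈F g)
f ≈F? g = isZeroₚ? (num (f -F g))

coefA coefB coefC : Fn
coefA = (nat 4 *F varA) -F nat 1
coefB = nat 16 *F varA
coefC = (nat 64 *F varA *F varA) -F (nat 16 *F varA)

data Point : Set where
  O   : Point
  aff : Fn → Fn → Point

OnE : Point → Set
OnE O = ⊤
OnE (aff x y) = Valid x × Valid y ×
  (y *F y ≈F (x *F x *F x) +F (coefA *F x *F x) +F (coefB *F x) +F coefC)

_≈P_ : Point → Point → Set
O ≈P O = ⊤
O ≈P aff _ _ = ⊥
aff _ _ ≈P O = ⊥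
aff x₁ y₁ ≈P aff x₂ y₂ = (x₁ ≈F x₂) × (y₁ ≈F y₂)

addP : Point → Point → Point
addP O q = q
addP (aff x₁ y₁) O = aff x₁ y₁
addP (aff x₁ y₁) (aff x₂ y₂) with x₁ ≈F? x₂
... | no _ = third ((y₂ -F y₁) /F (x₂ -F x₁))
  where
  third : Fn → Point
  third λ' = let x₃ = (λ' *F λ') -F coefA -F x₁ -F x₂
             in aff x₃ (negF (y₁ +F (λ' *F (x₃ -F x₁))))
... | yes _ with (y₁ +F y₂) ≈F? constF 0ℚ
...   | yes _ = O
...   | no _ = third (((nat 3 *F x₁ *F x₁) +F (nat 2 *F coefA *F x₁) +F coefB)
                       /F (nat 2 *F y₁))
  where
  third : Fn → Point
  third λ' = let x₃ = (λ' *F λ') -F coefA -F x₁ -F x₂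
             in aff x₃ (negF (y₁ +F (λ' *F (x₃ -F x₁))))

mulP : ℕ → Point → Point
mulP zero p = O
mulP (suc n) p = addP p (mulP n p)

P₀ : Point
P₀ = aff (nat 2) ((nat 8 *F varA) +F nat 2)

{-# OPTIONS --safe #-}
module Submission where

-- Put b = 4a + 1.  The substitution X = x + b - 2 turns the curve into y² = X ((b - X)² + 4X), and
-- X ↦ (b - X)² / (4X) is a 2-isogeny onto the Legendre curve Y² = X (X + 1) (X + b).  There all
-- rational points are 2-torsion, by infinite descent on the degree of X = p / q.  After translation by
-- 2-torsion points, b does not divide p and b - 1 does not divide p + q, so p, q, p + q, p + bq are
-- pairwise coprime and are constants times squares.  Since p and p + bq have even degree and bq has odd
-- degree, deg p > deg bq, so the four constants agree modulo squares; hence the point can be halved and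
-- the half has smaller degree.  The points over 2-torsion are found directly: those other than O, ±P₀
-- and 2P₀ would make 1 - b = -4a a square.

-- The isogeny is there because the curve itself has a single nonzero 2-torsion point over ℚ(a): the
-- roots of (b - X)² + 4X involve the square root of 1 - b. The Legendre curve has all its 2-torsion
-- rational, so a point on it is twice another as soon as X, X + 1 and X + b are squares. The
-- obstacle is ℚ: constants are units but seldom squares, so coprimality leaves each factor
-- undetermined up to ℚ*/ℚ*². The odd degree of b decides this at infinity: once p dominates, p, p +
-- q and p + bq share a leading coefficient, and the constant of q is then forced by the product.
-- The equation is carried with a square factor e² in front, so that every change of variables only
-- has to preserve the quartic up to squares. The factor goes away before the quartic is split,
-- because a polynomial that is the square of a fraction is the square of a polynomial.

open import Defs
open import Algebra.Bundles using (CommutativeRing)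
import Algebra.Properties.Ring as RingProperties
import Algebra.Solver.Ring as RingSolver
open import Algebra.Solver.Ring.AlmostCommutativeRing
  using (fromCommutativeRing; _-Raw-AlmostCommutative⟶_)
open import Data.Empty using (⊥; ⊥-elim)
open import Data.Integer using (+_)
open import Data.List using ([]; _∷_)
open import Data.List.Relation.Unary.All using ([]; _∷_)
open import Data.Maybe using (Maybe; just; nothing)
open import Data.Nat as ℕ using (ℕ; zero; suc; _<_; _≤_; s≤s; z≤n)
import Data.Nat.Properties as ℕ
open import Data.Product using (_×_; _,_; Σ; ∃; ∃₂; proj₁; proj₂)
open import Data.Rational as ℚ using (ℚ; 0ℚ; 1ℚ)
import Data.Rational.Properties as ℚ
open import Data.Sum using (_⊎_; inj₁; inj₂)
open import Data.Unit using (tt)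
open import Level using (0ℓ)
open import Relation.Binary.Definitions using (Tri; tri<; tri≈; tri>)
open import Relation.Binary.PropositionalEquality as ≡ using (_≡_; _≢_)
open import Relation.Nullary using (¬_; Dec; yes; no)

-- Coprimality and divisibility in commutative ℚ-algebras

module ℚ-Algebra (R : CommutativeRing 0ℓ 0ℓ)
  (morphism : ℚ.+-*-rawRing -Raw-AlmostCommutative⟶ fromCommutativeRing R) where

  open CommutativeRing R hiding (zero)
  open _-Raw-AlmostCommutative⟶_ morphism renaming (⟦_⟧ to const) public

  private
    const≟ : ∀ p q → Maybe (const p ≈ const q)
    const≟ p q with p ℚ.≟ q
    ... | yes p≡q = just (reflexive (≡.cong const p≡q))
    ... | no  _   = nothing

  open RingSolver ℚ.+-*-rawRing (fromCommutativeRing R) morphism const≟ public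
    using (solve; Polynomial; _:=_; _:+_; _:*_; _:-_; :-_; con)

  𝟙 : Carrier
  𝟙 = const 1ℚ

  :1 : ∀ {n} → Polynomial n
  :1 = con 1ℚ

  open import Relation.Binary.Reasoning.Setoid setoid public

  x-y≈0⇒x≈y : ∀ {x y} → x - y ≈ 0# → x ≈ y
  x-y≈0⇒x≈y {x} {y} h = begin
    x           ≈⟨ solve 2 (λ x y → x := (x :- y) :+ y) refl x y ⟩
    (x - y) + y ≈⟨ +-congʳ h ⟩
    0# + y      ≈⟨ +-identityˡ y ⟩
    y           ∎

  x≈y⇒x-y≈0 : ∀ {x y} → x ≈ y → x - y ≈ 0#
  x≈y⇒x-y≈0 {x} {y} h = trans (+-congʳ h) (-‿inverseʳ y)

  -- The ring solver proves identities only; a hypothesis `l ≈ r` enters by exhibiting `L - M` as a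
  -- multiple of `l - r`, which is again an identity.
  combine : ∀ c {l r L M} → l ≈ r → L - M ≈ c * (l - r) → L ≈ M
  combine c h e = x-y≈0⇒x≈y (trans e (trans (*-congˡ (x≈y⇒x-y≈0 h)) (zeroʳ c)))

  combine₂ : ∀ c d {l r l′ r′ L M} → l ≈ r → l′ ≈ r′ →
             L - M ≈ c * (l - r) + d * (l′ - r′) → L ≈ M
  combine₂ c d h h′ e = x-y≈0⇒x≈y (trans e (trans
    (+-cong (trans (*-congˡ (x≈y⇒x-y≈0 h)) (zeroʳ c)) (trans (*-congˡ (x≈y⇒x-y≈0 h′)) (zeroʳ d)))
    (+-identityˡ 0#)))

  Coprime : Carrier → Carrier → Set
  Coprime x y = ∃₂ λ u v → u * x + v * y ≈ 𝟙

  _∣_ : Carrier → Carrier → Set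
  x ∣ y = ∃ λ z → y ≈ x * z

  coprime-sym : ∀ {x y} → Coprime x y → Coprime y x
  coprime-sym (u , v , h) = v , u , trans (+-comm _ _) h

  coprime-resp : ∀ {x y x′ y′} → x ≈ x′ → y ≈ y′ → Coprime x y → Coprime x′ y′
  coprime-resp x≈ y≈ (u , v , h) =
    u , v , trans (+-cong (*-congˡ (sym x≈)) (*-congˡ (sym y≈))) h

  -- The two Bezout relations multiply to (ux + vy)(u′x + v′z) = 1, in which the only term not
  -- divisible by x is vv′yz.
  coprime-* : ∀ {x y z} → Coprime x y → Coprime x z → Coprime x (y * z)
  coprime-* {x} {y} {z} (u , v , h) (u′ , v′ , h′) =
    u * u′ * x + u * v′ * z + v * u′ * y , v * v′ ,
    combine₂ (u′ * x + v′ * z) 𝟙 h h′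
      (solve 7 (λ x y z u v u′ v′ →
         (u :* u′ :* x :+ u :* v′ :* z :+ v :* u′ :* y) :* x :+ v :* v′ :* (y :* z) :- :1
         := (u′ :* x :+ v′ :* z) :* (u :* x :+ v :* y :- :1)
            :+ :1 :* (u′ :* x :+ v′ :* z :- :1))
       refl x y z u v u′ v′)

  coprime-∣ : ∀ {x y z} → Coprime x y → x ∣ (y * z) → x ∣ z
  coprime-∣ {x} {y} {z} (u , v , h) (w , k) = u * z + v * w ,
    combine₂ (- z) v h k
      (solve 6 (λ x y z u v w →
         z :- x :* (u :* z :+ v :* w)
         := (:- z) :* (u :* x :+ v :* y :- :1) :+ v :* (y :* z :- x :* w))
       refl x y z u v w)

  -- Stating coprimality for the cofactors makes sense for x = y = 0 too, with g = 0, and directly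
  -- yields a fraction in lowest terms.
  record BezoutForm (x y : Carrier) : Set where
    field
      {g x′ y′} : Carrier
      x≈gx′     : x ≈ g * x′
      y≈gy′     : y ≈ g * y′
      coprime   : Coprime x′ y′

  module BezoutDomain
    (integral : ∀ {x y} → ¬ x ≈ 0# → ¬ y ≈ 0# → ¬ x * y ≈ 0#)
    (_≟0 : ∀ x → Dec (x ≈ 0#))
    (bezout : ∀ x y → BezoutForm x y) where

    factorˡ≉0 : ∀ {x y} → ¬ x * y ≈ 0# → ¬ x ≈ 0#
    factorˡ≉0 n h = n (trans (*-congʳ h) (zeroˡ _))

    factorʳ≉0 : ∀ {x y} → ¬ x * y ≈ 0# → ¬ y ≈ 0#
    factorʳ≉0 n h = n (trans (*-congˡ h) (zeroʳ _))

    *-cancelˡ : ∀ {x y z} → ¬ x ≈ 0# → x * y ≈ x * z → y ≈ z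
    *-cancelˡ {x} {y} {z} x≉0 h with (y - z) ≟0
    ... | yes y-z≈0 = x-y≈0⇒x≈y y-z≈0
    ... | no  y-z≉0 = ⊥-elim (integral x≉0 y-z≉0 (trans
            (solve 3 (λ x y z → x :* (y :- z) := x :* y :- x :* z) refl x y z)
            (x≈y⇒x-y≈0 h)))

    -- Integral closedness: once the common factor of e and r is cancelled, e′ divides r′² and is
    -- coprime to r′, hence divides r′.
    sqrt : ∀ {e z r} → ¬ e ≈ 0# → e * e * z ≈ r * r → ∃ λ s → z ≈ s * s
    sqrt {e} {z} {r} e≉0 h = s , *-cancelˡ (integral e′≉0 e′≉0) (begin
      e′ * e′ * z           ≈⟨ e′²z≈r′² ⟩
      r′ * r′               ≈⟨ *-cong r′≈e′s r′≈e′s ⟩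
      (e′ * s) * (e′ * s)   ≈⟨ solve 2 (λ e s → (e :* s) :* (e :* s) := e :* e :* (s :* s)) refl e′ s ⟩
      e′ * e′ * (s * s)     ∎)
      where
      open BezoutForm (bezout e r) renaming (x′ to e′; y′ to r′; x≈gx′ to e≈; y≈gy′ to r≈; coprime to cop)
      ge′≉0 : ¬ g * e′ ≈ 0#
      ge′≉0 = λ t → e≉0 (trans e≈ t)
      g≉0 : ¬ g ≈ 0#
      g≉0 = factorˡ≉0 ge′≉0
      e′≉0 : ¬ e′ ≈ 0#
      e′≉0 = factorʳ≉0 ge′≉0
      e′²z≈r′² : e′ * e′ * z ≈ r′ * r′
      e′²z≈r′² = *-cancelˡ (integral g≉0 g≉0) (begin
        g * g * (e′ * e′ * z)       ≈⟨ solve 3 (λ g e z → g :* g :* (e :* e :* z) := (g :* e) :* (g :* e) :* z) refl g e′ z ⟩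
        (g * e′) * (g * e′) * z     ≈⟨ *-congʳ (*-cong e≈ e≈) ⟨
        e * e * z                   ≈⟨ h ⟩
        r * r                       ≈⟨ *-cong r≈ r≈ ⟩
        (g * r′) * (g * r′)         ≈⟨ solve 2 (λ g r → (g :* r) :* (g :* r) := g :* g :* (r :* r)) refl g r′ ⟩
        g * g * (r′ * r′)           ∎)
      e′∣r′ : e′ ∣ r′
      e′∣r′ = coprime-∣ cop (e′ * z , trans (sym e′²z≈r′²) (*-assoc e′ e′ z))
      s : Carrier
      s = proj₁ e′∣r′
      r′≈e′s : r′ ≈ e′ * s
      r′≈e′s = proj₂ e′∣r′

    -- This takes the place of unique factorisation. With g the common factor of x and s, x′y = g
    -- s′² and x′ is coprime to s′, so x′ divides g, say g = x′h. Then x = h x′² and y = h s′², so h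
    -- divides ux + vy = 1.
    coprime-factor-of-square : ∀ {x y s} → Coprime x y → ¬ s ≈ 0# → x * y ≈ s * s →
      ∃₂ λ h z → x ≈ h * (z * z) × h ∣ 𝟙
    coprime-factor-of-square {x} {y} {s} (u , v , ux+vy≈1) s≉0 xy≈s² =
      h , x′ , x≈hx′² , (u * (x′ * x′) + v * (s′ * s′) , h∣1)
      where
      open BezoutForm (bezout x s) renaming (y′ to s′; x≈gx′ to x≈; y≈gy′ to s≈; coprime to cop)
      gs′≉0 : ¬ g * s′ ≈ 0#
      gs′≉0 = λ t → s≉0 (trans s≈ t)
      g≉0 : ¬ g ≈ 0#
      g≉0 = factorˡ≉0 gs′≉0
      x≉0 : ¬ x ≈ 0#
      x≉0 = factorˡ≉0 (λ t → integral s≉0 s≉0 (trans (sym xy≈s²) t))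
      x′≉0 : ¬ x′ ≈ 0#
      x′≉0 = factorʳ≉0 (λ t → x≉0 (trans x≈ t))
      x′y≈gs′² : x′ * y ≈ s′ * (s′ * g)
      x′y≈gs′² = *-cancelˡ g≉0 (begin
        g * (x′ * y)          ≈⟨ *-assoc g x′ y ⟨
        g * x′ * y            ≈⟨ *-congʳ x≈ ⟨
        x * y                 ≈⟨ xy≈s² ⟩
        s * s                 ≈⟨ *-cong s≈ s≈ ⟩
        (g * s′) * (g * s′)   ≈⟨ solve 2 (λ g s → (g :* s) :* (g :* s) := g :* (s :* (s :* g))) refl g s′ ⟩
        g * (s′ * (s′ * g))   ∎)
      x′∣g : x′ ∣ g
      x′∣g = coprime-∣ cop (coprime-∣ cop (y , sym x′y≈gs′²))
      h : Carrier
      h = proj₁ x′∣g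
      g≈x′h : g ≈ x′ * h
      g≈x′h = proj₂ x′∣g
      x≈hx′² : x ≈ h * (x′ * x′)
      x≈hx′² = trans x≈ (trans (*-congʳ g≈x′h)
        (solve 2 (λ x h → x :* h :* x := h :* (x :* x)) refl x′ h))
      y≈hs′² : y ≈ h * (s′ * s′)
      y≈hs′² = *-cancelˡ x′≉0 (trans x′y≈gs′² (trans (*-congˡ (*-congˡ g≈x′h))
        (solve 3 (λ x h s → s :* (s :* (x :* h)) := x :* (h :* (s :* s))) refl x′ h s′)))
      h∣1 : const 1ℚ ≈ h * (u * (x′ * x′) + v * (s′ * s′))
      h∣1 = begin
        𝟙                                              ≈⟨ ux+vy≈1 ⟨
        u * x + v * y                                  ≈⟨ +-cong (*-congˡ x≈hx′²) (*-congˡ y≈hs′²) ⟩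
        u * (h * (x′ * x′)) + v * (h * (s′ * s′))      ≈⟨ solve 5 (λ h u v x s → u :* (h :* (x :* x)) :+ v :* (h :* (s :* s)) := h :* (u :* (x :* x) :+ v :* (s :* s))) refl h u v x′ s′ ⟩
        h * (u * (x′ * x′) + v * (s′ * s′))            ∎

-- An abstract interface to ℚ[a]: Lead p n c says that p has degree n and leading coefficient c,
-- and Below n p that p is zero or has degree less than n.
record PolynomialDomain : Set₁ where
  field
    ring     : CommutativeRing 0ℓ 0ℓ
    morphism : ℚ.+-*-rawRing -Raw-AlmostCommutative⟶ fromCommutativeRing ring
  open CommutativeRing ring public
    using (Carrier; _≈_; _+_; _*_; -_; _-_; 0#; 1#; refl; sym; trans)
  open CommutativeRing ring using (*-congˡ; *-congʳ; +-cong; +-congˡ; +-congʳ; +-identityʳ; zeroʳ; reflexive)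
  open ℚ-Algebra ring morphism public
  field
    Lead        : Carrier → ℕ → ℚ → Set
    lead?       : ∀ x → x ≈ 0# ⊎ ∃₂ λ n c → Lead x n c
    lead-resp   : ∀ {x y n c} → x ≈ y → Lead x n c → Lead y n c
    lead≉0      : ∀ {x n c} → Lead x n c → ¬ x ≈ 0#
    lead-unique : ∀ {x n m c d} → Lead x n c → Lead x m d → n ≡ m × c ≡ d
    lead-*      : ∀ {x y n m c d} → Lead x n c → Lead y m d → Lead (x * y) (n ℕ.+ m) (c ℚ.* d)
    lead-+      : ∀ {x y n m c d} → Lead x n c → Lead y m d → m < n → Lead (x + y) n c
    lead-0      : ∀ {x c} → Lead x 0 c → x ≈ const c
    const-lead  : ∀ {c} → c ≢ 0ℚ → Lead (const c) 0 c
    lead-≢0     : ∀ {x n c} → Lead x n c → c ≢ 0ℚ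
    Below       : ℕ → Carrier → Set
    below-resp  : ∀ {n x y} → x ≈ y → Below n x → Below n y
    below-0#    : ∀ {n} → Below n 0#
    below-+     : ∀ {n x y} → Below n x → Below n y → Below n (x + y)
    below-neg   : ∀ {n x} → Below n x → Below n (- x)
    lead⇒below  : ∀ {n m x c} → Lead x n c → n < m → Below m x
    below⇒lead< : ∀ {n m x c} → Below m x → Lead x n c → n < m
    below-0     : ∀ {x} → Below 0 x → x ≈ 0#
    below-suc   : ∀ {n x} → Below (suc n) x → Below n x ⊎ ∃ (Lead x n)
    division    : ∀ {y m d} → Lead y m d → ∀ x → ∃₂ λ k r → x ≈ y * k + r × Below m r

  -- Consequences of Euclidean division

  _≟0 : ∀ x → Dec (x ≈ 0#)
  x ≟0 with lead? x
  ... | inj₁ x≈0         = yes x≈0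
  ... | inj₂ (_ , _ , l) = no (lead≉0 l)

  integral : ∀ {x y} → ¬ x ≈ 0# → ¬ y ≈ 0# → ¬ x * y ≈ 0#
  integral {x} {y} x≉0 y≉0 with lead? x | lead? y
  ... | inj₁ x≈0 | _        = ⊥-elim (x≉0 x≈0)
  ... | inj₂ _   | inj₁ y≈0 = ⊥-elim (y≉0 y≈0)
  ... | inj₂ (_ , _ , l) | inj₂ (_ , _ , m) = lead≉0 (lead-* l m)

  -- Euclid's algorithm as a product of elementary matrices: no division by the gcd is needed.
  below-bezout : ∀ n x {y} → Below n y → BezoutForm x y
  below-bezout zero x {y} bl = record
    { g = x ; x′ = 𝟙 ; y′ = 0#
    ; x≈gx′ = solve 1 (λ x → x := x :* :1) refl x
    ; y≈gy′ = trans (below-0 bl) (sym (zeroʳ x))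
    ; coprime = 𝟙 , 0# , trans (+-congˡ (zeroʳ 0#)) (trans (+-identityʳ _) (solve 0 (:1 :* :1 := :1) refl))
    }
  below-bezout (suc n) x {y} bl with below-suc bl
  ... | inj₁ bl′     = below-bezout n x bl′
  ... | inj₂ (d , l) = swap (division l x)
    where
    swap : (∃₂ λ k r → x ≈ y * k + r × Below n r) → BezoutForm x y
    swap (k , r , x≈yk+r , bl-r) = rebuild (below-bezout n y bl-r)
      where
      rebuild : BezoutForm y r → BezoutForm x y
      rebuild bez = record
        { g = g ; x′ = x′ * k + y′ ; y′ = x′
        ; x≈gx′ = trans x≈yk+r (trans (+-cong (*-congʳ x≈gx′) y≈gy′)
            (solve 4 (λ g x y k → g :* x :* k :+ g :* y := g :* (x :* k :+ y)) refl g x′ y′ k))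
        ; y≈gy′ = x≈gx′
        ; coprime = let u , v , h = coprime in v , u - v * k ,
            trans (solve 5 (λ u v x y k → v :* (x :* k :+ y) :+ (u :- v :* k) :* x := u :* x :+ v :* y) refl u v x′ y′ k) h
        }
        where open BezoutForm bez

  -- The remainder modulo a polynomial of degree one is a constant: zero means divisibility, and a
  -- nonzero d becomes a Bezout relation after scaling by its inverse.
  linear-prime : ∀ {l c} → Lead l 1 c → ∀ x → l ∣ x ⊎ Coprime x l
  linear-prime {l} lead-l x with division lead-l x
  ... | k , r , x≈lk+r , bl with below-suc bl
  ... | inj₁ bl′ = inj₁ (k , trans x≈lk+r (trans (+-congˡ (below-0 bl′)) (+-identityʳ _)))
  ... | inj₂ (d , lead-r) = inj₂ (const d⁻¹ , - (const d⁻¹ * k) , (begin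
    const d⁻¹ * x + - (const d⁻¹ * k) * l
      ≈⟨ +-congʳ (*-congˡ (trans x≈lk+r (+-congˡ (lead-0 lead-r)))) ⟩
    const d⁻¹ * (l * k + const d) + - (const d⁻¹ * k) * l
      ≈⟨ solve 4 (λ i l k d → i :* (l :* k :+ d) :+ (:- (i :* k)) :* l := i :* d) refl (const d⁻¹) l k (const d) ⟩
    const d⁻¹ * const d ≈⟨ *-homo d⁻¹ d ⟨
    const (d⁻¹ ℚ.* d)   ≈⟨ reflexive (≡.cong const (ℚ.*-inverseˡ d {{ℚ.≢-nonZero (lead-≢0 lead-r)}})) ⟩
    𝟙 ∎))
    where
    d⁻¹ : ℚ
    d⁻¹ = ℚ.1/_ d {{ℚ.≢-nonZero (lead-≢0 lead-r)}}

  bezout : ∀ x y → BezoutForm x y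
  bezout x y with lead? y
  ... | inj₁ y≈0         = below-bezout 0 x (below-resp (sym y≈0) below-0#)
  ... | inj₂ (n , _ , l) = below-bezout (suc n) x (lead⇒below l (ℕ.n<1+n n))

  open BezoutDomain integral _≟0 bezout public

-- Infinite descent on Y² = X (X + 1) (X + b)

module LegendreDescent (P : PolynomialDomain) where
  open PolynomialDomain P
  open CommutativeRing ring using (*-cong; *-congˡ; *-congʳ; +-cong; +-congˡ; +-congʳ; -‿cong; zeroˡ; zeroʳ; *-comm; +-comm)

  odd≢even : ∀ m n → suc (m ℕ.+ m) ≢ n ℕ.+ n
  odd≢even m n eq = ℕ.even≢odd n m (≡.trans (≡.cong (n ℕ.+_) (ℕ.+-identityʳ n))
    (≡.trans (≡.sym eq) (≡.cong (λ t → suc (m ℕ.+ t)) (≡.sym (ℕ.+-identityʳ m)))))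

  lead-of : ∀ {x} → ¬ x ≈ 0# → ∃₂ λ n c → Lead x n c
  lead-of {x} x≉0 with lead? x
  ... | inj₁ x≈0 = ⊥-elim (x≉0 x≈0)
  ... | inj₂ l   = l

  -- Degrees add, so cancelling a nonzero factor never breaks a degree bound.
  below-factor : ∀ {n x y} → ¬ x ≈ 0# → Below n (x * y) → Below n y
  below-factor {n} {x} {y} x≉0 bl with lead? y
  ... | inj₁ y≈0 = below-resp (sym y≈0) below-0#
  ... | inj₂ (m , _ , ly) with lead-of x≉0
  ...   | k , _ , lx = lead⇒below ly (ℕ.≤-<-trans (ℕ.m≤n+m m k) (below⇒lead< bl (lead-* lx ly)))

  unit-constant : ∀ {h} → h ∣ 𝟙 → ∃ λ c → h ≈ const c × c ≢ 0ℚ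
  unit-constant {h} (k , 1≈hk) = c , lead-0 l′ , lead-≢0 l′
    where
    hk≉0 : ¬ h * k ≈ 0#
    hk≉0 t = lead≉0 (const-lead (λ ())) (trans 1≈hk t)
    lh = lead-of (factorˡ≉0 hk≉0)
    lk = lead-of (factorʳ≉0 hk≉0)
    c = proj₁ (proj₂ lh)
    n+m≡0 = proj₁ (lead-unique (lead-resp (sym 1≈hk) (lead-* (proj₂ (proj₂ lh)) (proj₂ (proj₂ lk)))) (const-lead (λ ())))
    l′ : Lead h 0 c
    l′ = ≡.subst (λ n → Lead h n c) (ℕ.m+n≡0⇒m≡0 _ n+m≡0) (proj₂ (proj₂ lh))

  -- Multiplying by its leading coefficient l makes a unit times a square into a square.
  record MonicSquare (x : Carrier) (n : ℕ) (l : ℚ) : Set where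
    field
      root     : Carrier
      half     : ℕ
      {rootlc} : ℚ
      rootlead : Lead root half rootlc
      deg      : n ≡ half ℕ.+ half
      square   : const l * x ≈ root * root

  -- `coprime-factor-of-square` gives x = c z² with c a constant. If ζ is the leading coefficient of
  -- z, then l = c ζ², so l x = (c ζ z)².
  monic-square : ∀ {x y s n l} → Coprime x y → ¬ s ≈ 0# → x * y ≈ s * s → Lead x n l → MonicSquare x n l
  monic-square {x} {y} {s} {n} {l} cop s≉0 xy≈s² lx = record
    { root = const (c ℚ.* ζ) * z ; half = k
    ; rootlead = lead-* (const-lead (lead-≢0 (lead-* (const-lead c≢0) lz))) lz
    ; deg = proj₁ uniq
    ; square = begin
        const l * x                                   ≈⟨ *-cong (≡-const (proj₂ uniq)) x≈cz² ⟩
        const (c ℚ.* (ζ ℚ.* ζ)) * (const c * (z * z)) ≈⟨ *-congʳ (trans (*-homo c _) (*-congˡ (*-homo ζ ζ))) ⟩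
        const c * (const ζ * const ζ) * (const c * (z * z))
          ≈⟨ solve 3 (λ c ζ z → c :* (ζ :* ζ) :* (c :* (z :* z)) := c :* ζ :* z :* (c :* ζ :* z)) refl (const c) (const ζ) z ⟩
        const c * const ζ * z * (const c * const ζ * z) ≈⟨ *-cong (*-congʳ (*-homo c ζ)) (*-congʳ (*-homo c ζ)) ⟨
        const (c ℚ.* ζ) * z * (const (c ℚ.* ζ) * z) ∎
    }
    where
    ≡-const : ∀ {p q} → p ≡ q → const p ≈ const q
    ≡-const ≡.refl = refl
    factor = coprime-factor-of-square cop s≉0 xy≈s²
    z = proj₁ (proj₂ factor)
    unit = unit-constant (proj₂ (proj₂ (proj₂ factor)))
    c = proj₁ unit
    c≢0 = proj₂ (proj₂ unit)
    x≈cz² : x ≈ const c * (z * z)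
    x≈cz² = trans (proj₁ (proj₂ (proj₂ factor))) (*-congʳ (proj₁ (proj₂ unit)))
    z≉0 : ¬ z ≈ 0#
    z≉0 t = lead≉0 lx (trans x≈cz² (trans (*-congˡ (trans (*-congˡ t) (zeroʳ z))) (zeroʳ _)))
    k = proj₁ (lead-of z≉0)
    ζ = proj₁ (proj₂ (lead-of z≉0))
    lz : Lead z k ζ
    lz = proj₂ (proj₂ (lead-of z≉0))
    uniq = lead-unique lx (lead-resp (sym x≈cz²) (lead-* (const-lead c≢0) (lead-* lz lz)))

  module _ {b β γ} (lead-b : Lead b 1 β) (lead-b-1 : Lead (b - 𝟙) 1 γ) where

    private
      b≉0 = lead≉0 lead-b
      b-1≉0 = lead≉0 lead-b-1

    -- p / q is the abscissa of a point of Y² = X (X + 1) (X + b) that is not 2-torsion.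
    record Solution (p q : Carrier) : Set where
      constructor solution
      field
        {e r} : Carrier
        e≉0   : ¬ e ≈ 0#
        r≉0   : ¬ r ≈ 0#
        eqn   : e * e * (p * q * (p + q) * (p + b * q)) ≈ r * r

      product≉0 : ¬ p * q * (p + q) * (p + b * q) ≈ 0#
      product≉0 = factorʳ≉0 (λ t → integral r≉0 r≉0 (trans (sym eqn) t))
      p+bq≉0 = factorʳ≉0 product≉0
      p+q≉0 = factorʳ≉0 (factorˡ≉0 product≉0)
      q≉0 = factorʳ≉0 (factorˡ≉0 (factorˡ≉0 product≉0))
      p≉0 = factorˡ≉0 (factorˡ≉0 (factorˡ≉0 product≉0))

    -- Upper bounds in place of exact degrees let translations and sums be estimated without
    -- following cancellations.
    record Bounded (n : ℕ) (p q : Carrier) : Set where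
      constructor bounded
      field
        sol    : Solution p q
        bound₁ : Below n p
        bound₂ : Below n q

    make-coprime : ∀ {n p q} → Bounded n p q → ∃₂ λ p q → Bounded n p q × Coprime p q
    make-coprime {n} {p} {q} (bounded s bp bq) = p′ , q′ ,
      bounded
        -- The quartic form is homogeneous of degree 4 in (p, q), so the common factor g comes out
        -- as the square of g².
        (solution {e = e * (g * g)} {r = r} (integral e≉0 (integral g≉0 g≉0)) r≉0 (begin
          e * (g * g) * (e * (g * g)) * (p′ * q′ * (p′ + q′) * (p′ + b * q′))
            ≈⟨ solve 5 (λ e g p q b → e :* (g :* g) :* (e :* (g :* g)) :* (p :* q :* (p :+ q) :* (p :+ b :* q))
                 := e :* e :* (g :* p :* (g :* q) :* (g :* p :+ g :* q) :* (g :* p :+ b :* (g :* q)))) refl e g p′ q′ b ⟩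
          e * e * (g * p′ * (g * q′) * (g * p′ + g * q′) * (g * p′ + b * (g * q′)))
            ≈⟨ *-congˡ (*-cong (*-cong (*-cong p≈ q≈) (+-cong p≈ q≈)) (+-cong p≈ (*-congˡ q≈))) ⟨
          e * e * (p * q * (p + q) * (p + b * q)) ≈⟨ eqn ⟩
          r * r ∎))
        (below-factor g≉0 (below-resp p≈ bp)) (below-factor g≉0 (below-resp q≈ bq))
      , cop
      where
      open Solution s
      open BezoutForm (bezout p q) renaming (x′ to p′; y′ to q′; x≈gx′ to p≈; y≈gy′ to q≈; coprime to cop)
      g≉0 : ¬ g ≈ 0#
      g≉0 = factorˡ≉0 (λ t → p≉0 (trans p≈ t))

    -- Translation by (0, 0) is X ↦ b/X and takes p/q = bw/q to q/w. One step is enough: q is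
    -- coprime to p = bw, hence to b.
    make-coprime-b : ∀ {n p q} → Bounded n p q → Coprime p q →
                     ∃₂ λ p q → Bounded n p q × Coprime p q × Coprime p b
    make-coprime-b {n} {p} {q} bd@(bounded s bp bq) cop@(u , v , up+vq≈1) with linear-prime lead-b p
    ... | inj₂ cop-b = p , q , bd , cop , cop-b
    ... | inj₁ (w , p≈bw) = q , w ,
      bounded
        (solution {e = e * b} {r = r} (integral e≉0 b≉0) r≉0 (begin
          e * b * (e * b) * (q * w * (q + w) * (q + b * w))
            ≈⟨ solve 4 (λ e b w q → e :* b :* (e :* b) :* (q :* w :* (q :+ w) :* (q :+ b :* w))
                := e :* e :* (b :* w :* q :* (b :* w :+ q) :* (b :* w :+ b :* q))) refl e b w q ⟩
          e * e * (b * w * q * (b * w + q) * (b * w + b * q))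
            ≈⟨ *-congˡ (*-cong (*-cong (*-congʳ p≈bw) (+-congʳ p≈bw)) (+-congʳ p≈bw)) ⟨
          e * e * (p * q * (p + q) * (p + b * q)) ≈⟨ eqn ⟩
          r * r ∎))
        bq (below-factor b≉0 (below-resp p≈bw bp))
      , (v , u * b , trans (solve 5 (λ u v b w q → v :* q :+ u :* b :* w := u :* (b :* w) :+ v :* q) refl u v b w q) upbw)
      , (v , u * w , trans (solve 5 (λ u v b w q → v :* q :+ u :* w :* b := u :* (b :* w) :+ v :* q) refl u v b w q) upbw)
      where
      open Solution s
      upbw : u * (b * w) + v * q ≈ 𝟙
      upbw = trans (+-congʳ (*-congˡ (sym p≈bw))) up+vq≈1

    -- Translation by (-1, 0) is X ↦ -(X + b)/(X + 1); when p + q = (b - 1)w it takes p/q to -(w +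
    -- q)/w. Modulo b the new p equals the old one, so coprimality to b survives. The new sum p + q
    -- is -q, coprime to the old p + q and hence to b - 1.
    make-coprime-b-1 : ∀ {n p q} → Bounded n p q → Coprime p q → Coprime p b →
      ∃₂ λ p q → Bounded n p q × Coprime p q × Coprime p b × Coprime (p + q) (b - 𝟙)
    make-coprime-b-1 {n} {p} {q} bd@(bounded s bp bq) cop@(u , v , up+vq≈1) cop-b@(k , l , kp+lb≈1)
      with linear-prime lead-b-1 (p + q)
    ... | inj₂ cop-b-1 = p , q , bd , cop , cop-b , cop-b-1
    ... | inj₁ (w , p+q≈) = - (w + q) , w ,
      bounded
        (solution {e = e * (b - 𝟙)} {r = r} (integral e≉0 b-1≉0) r≉0 (begin
          e * (b - 𝟙) * (e * (b - 𝟙)) * (- (w + q) * w * (- (w + q) + w) * (- (w + q) + b * w))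
            ≈⟨ solve 4 (λ e b w q → e :* (b :- :1) :* (e :* (b :- :1)) :* ((:- (w :+ q)) :* w :* ((:- (w :+ q)) :+ w) :* ((:- (w :+ q)) :+ b :* w))
                := e :* e :* (((b :- :1) :* w :- q) :* q :* (((b :- :1) :* w :- q) :+ q) :* (((b :- :1) :* w :- q) :+ b :* q))) refl e b w q ⟩
          e * e * (((b - 𝟙) * w - q) * q * (((b - 𝟙) * w - q) + q) * (((b - 𝟙) * w - q) + b * q))
            ≈⟨ *-congˡ (*-cong (*-cong (*-congʳ p≈) (+-congʳ p≈)) (+-congʳ p≈)) ⟨
          e * e * (p * q * (p + q) * (p + b * q)) ≈⟨ eqn ⟩
          r * r ∎))
        (below-neg (below-+ bw bq)) bw
      , (u - v , u * b - v , trans (solve 5 (λ u v b w q → (u :- v) :* (:- (w :+ q)) :+ (u :* b :- v) :* w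
            := u :* ((b :- :1) :* w :- q) :+ v :* q) refl u v b w q) (trans (+-congʳ (*-congˡ (sym p≈))) up+vq≈1))
      , (k , l + k * w , trans (solve 5 (λ k l b w q → k :* (:- (w :+ q)) :+ (l :+ k :* w) :* b
            := k :* ((b :- :1) :* w :- q) :+ l :* b) refl k l b w q) (trans (+-congʳ (*-congˡ (sym p≈))) kp+lb≈1))
      , (u - v , u * w , trans (solve 5 (λ u v b w q → (u :- v) :* (:- (w :+ q) :+ w) :+ (u :* w) :* (b :- :1)
            := u :* ((b :- :1) :* w :- q) :+ v :* q) refl u v b w q) (trans (+-congʳ (*-congˡ (sym p≈))) up+vq≈1))
      where
      open Solution s
      p≈ : p ≈ (b - 𝟙) * w - q
      p≈ = combine 𝟙 p+q≈ (solve 4 (λ p q b w → p :- ((b :- :1) :* w :- q) := :1 :* (p :+ q :- (b :- :1) :* w)) refl p q b w)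
      bw : Below n w
      bw = below-factor b-1≉0 (below-resp p+q≈ (below-+ bp bq))

    coprime-shift : ∀ {x y} z → Coprime x y → Coprime x (y + z * x)
    coprime-shift {x} {y} z (u , v , h) = u - v * z , v ,
      trans (solve 5 (λ x y z u v → (u :- v :* z) :* x :+ v :* (y :+ z :* x) := u :* x :+ v :* y) refl x y z u v) h

    -- Such a quadruple halves the point: one of the halves is (A + C) / (B - A).
    record SquareSystem (n : ℕ) : Set where
      field
        {A B C D}   : Carrier
        {k}         : ℕ
        {α β′ γ′}   : ℚ
        A²+D²≈B²    : A * A + D * D ≈ B * B
        A²+bD²≈C²   : A * A + b * (D * D) ≈ C * C
        D≉0         : ¬ D ≈ 0#
        lead-A      : Lead A k α
        lead-B      : Lead B k β′
        lead-C      : Lead C k γ′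
        k>0         : 0 < k
        k+k<n       : k ℕ.+ k < n

    -- Scaling by Λ, the leading coefficient shared by p, p + q and p + bq, makes these three the
    -- squares A², B², C². Since Λ⁴ times the quartic is a square, so is (ABC)² Λq, and `sqrt`
    -- yields D.
    scaled-square-system : ∀ {n p q s np nq lp} → Below n p → ¬ q ≈ 0# → p * q * (p + q) * (p + b * q) ≈ s * s →
      Lead p np lp → suc nq < np →
      MonicSquare p np lp → MonicSquare (p + q) np lp → MonicSquare (p + b * q) np lp → SquareSystem n
    scaled-square-system {n} {p} {q} {s} {np} {nq} {lp} bp q≉0 product≈s² lead-p 1+nq<np M₁ M₃ M₄ =
      system (sqrt {r = Λ * Λ * s} ABC≉0 (begin
        A * B * C * (A * B * C) * (Λ * q)
          ≈⟨ solve 4 (λ A B C q → A :* B :* C :* (A :* B :* C) :* q := A :* A :* (B :* B) :* (C :* C) :* q) refl A B C (Λ * q) ⟩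
        A * A * (B * B) * (C * C) * (Λ * q)
          ≈⟨ *-congʳ (*-cong (*-cong M₁.square M₃.square) M₄.square) ⟨
        Λ * p * (Λ * (p + q)) * (Λ * (p + b * q)) * (Λ * q)
          ≈⟨ solve 5 (λ l p q r t → l :* p :* (l :* r) :* (l :* t) :* (l :* q) := l :* l :* (l :* l) :* (p :* q :* r :* t))
               refl Λ p q (p + q) (p + b * q) ⟩
        Λ * Λ * (Λ * Λ) * (p * q * (p + q) * (p + b * q))
          ≈⟨ *-congˡ product≈s² ⟩
        Λ * Λ * (Λ * Λ) * (s * s)
          ≈⟨ solve 2 (λ l s → l :* l :* (l :* l) :* (s :* s) := l :* l :* s :* (l :* l :* s)) refl Λ s ⟩
        Λ * Λ * s * (Λ * Λ * s) ∎))
      where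
      module M₁ = MonicSquare M₁
      module M₃ = MonicSquare M₃
      module M₄ = MonicSquare M₄
      A = M₁.root
      B = M₃.root
      C = M₄.root
      k = M₁.half
      Λ = const lp
      Λ≉0 : ¬ Λ ≈ 0#
      Λ≉0 = lead≉0 (const-lead (lead-≢0 lead-p))
      ABC≉0 : ¬ A * B * C ≈ 0#
      ABC≉0 = integral (integral (lead≉0 M₁.rootlead) (lead≉0 M₃.rootlead)) (lead≉0 M₄.rootlead)
      halves : ∀ {m} → np ≡ m ℕ.+ m → m ≡ k
      halves {m} eq = ℕ.*-cancelˡ-≡ m k 2 (≡.trans (double m) (≡.trans (≡.sym eq) (≡.trans M₁.deg (≡.sym (double k)))))
        where
        double : ∀ m → 2 ℕ.* m ≡ m ℕ.+ m
        double m = ≡.cong (m ℕ.+_) (ℕ.+-identityʳ m)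
      positive : ∀ k {m} → m < k ℕ.+ k → 0 < k
      positive (suc k) _ = s≤s z≤n
      system : (∃ λ D → Λ * q ≈ D * D) → SquareSystem n
      system (D , Λq≈D²) = record
        { A = A ; B = B ; C = C ; D = D ; k = k
        ; A²+D²≈B² = begin
            A * A + D * D     ≈⟨ +-cong M₁.square Λq≈D² ⟨
            Λ * p + Λ * q     ≈⟨ solve 3 (λ l p q → l :* p :+ l :* q := l :* (p :+ q)) refl Λ p q ⟩
            Λ * (p + q)       ≈⟨ M₃.square ⟩
            B * B             ∎
        ; A²+bD²≈C² = begin
            A * A + b * (D * D)   ≈⟨ +-cong M₁.square (*-congˡ Λq≈D²) ⟨
            Λ * p + b * (Λ * q)   ≈⟨ solve 4 (λ l p q b → l :* p :+ b :* (l :* q) := l :* (p :+ b :* q)) refl Λ p q b ⟩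
            Λ * (p + b * q)       ≈⟨ M₄.square ⟩
            C * C                 ∎
        ; D≉0 = factorˡ≉0 (λ t → integral Λ≉0 q≉0 (trans Λq≈D² t))
        ; lead-A = M₁.rootlead
        ; lead-B = ≡.subst (λ n → Lead B n _) (halves M₃.deg) M₃.rootlead
        ; lead-C = ≡.subst (λ n → Lead C n _) (halves M₄.deg) M₄.rootlead
        ; k>0 = positive k (≡.subst (suc nq <_) M₁.deg 1+nq<np)
        ; k+k<n = ≡.subst (_< n) M₁.deg (below⇒lead< bp lead-p)
        }

    -- For coprime p and q only two pairs of factors could still share a divisor: p and p + bq
    -- differ by bq, p + q and p + bq by (b - 1)q. The last two hypotheses exclude b and b - 1.
    square-system : ∀ {n p q} → Bounded n p q → Coprime p q → Coprime p b → Coprime (p + q) (b - 𝟙) →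
                    SquareSystem n
    square-system {n} {p} {q} (bounded sol bp bq) cop-pq cop-pb cop-b-1 =
      system (sqrt e≉0 eqn) (lead-of p≉0) (lead-of q≉0)
      where
      open Solution sol

      cop-qp : Coprime q p
      cop-qp = coprime-sym cop-pq
      cop-p-p+q : Coprime p (p + q)
      cop-p-p+q = coprime-resp refl (solve 2 (λ p q → q :+ :1 :* p := p :+ q) refl p q) (coprime-shift 𝟙 cop-pq)
      cop-q-p+q : Coprime q (p + q)
      cop-q-p+q = coprime-resp refl (solve 2 (λ p q → p :+ :1 :* q := p :+ q) refl p q) (coprime-shift 𝟙 cop-qp)
      cop-p-p+bq : Coprime p (p + b * q)
      cop-p-p+bq = coprime-resp refl (solve 3 (λ p q b → b :* q :+ :1 :* p := p :+ b :* q) refl p q b)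
                     (coprime-shift 𝟙 (coprime-* cop-pb cop-pq))
      cop-q-p+bq : Coprime q (p + b * q)
      cop-q-p+bq = coprime-shift b cop-qp
      cop-p+q-p+bq : Coprime (p + q) (p + b * q)
      cop-p+q-p+bq = coprime-resp refl
        (solve 3 (λ p q b → (b :- :1) :* q :+ :1 :* (p :+ q) := p :+ b :* q) refl p q b)
        (coprime-shift 𝟙 (coprime-* cop-b-1 (coprime-sym cop-q-p+q)))

      system : (∃ λ s → p * q * (p + q) * (p + b * q) ≈ s * s) → ∃₂ (Lead p) → ∃₂ (Lead q) → SquareSystem n
      system (s , product≈s²) (np , lp , lead-p) (nq , lq , lead-q) = compare (ℕ.<-cmp np (suc nq))
        where
        s≉0 : ¬ s ≈ 0#
        s≉0 = factorˡ≉0 (λ t → product≉0 (trans product≈s² t))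
        lead-bq : Lead (b * q) (suc nq) (β ℚ.* lq)
        lead-bq = lead-* lead-b lead-q

        square-p : MonicSquare p np lp
        square-p = monic-square (coprime-* cop-pq (coprime-* cop-p-p+q cop-p-p+bq)) s≉0
          (trans (solve 4 (λ p q r t → p :* (q :* (r :* t)) := p :* q :* r :* t) refl p q (p + q) (p + b * q)) product≈s²)
          lead-p
        square-q : MonicSquare q nq lq
        square-q = monic-square (coprime-* cop-qp (coprime-* cop-q-p+q cop-q-p+bq)) s≉0
          (trans (solve 4 (λ p q r t → q :* (p :* (r :* t)) := p :* q :* r :* t) refl p q (p + q) (p + b * q)) product≈s²)
          lead-q
        square-p+q : ∀ {m l} → Lead (p + q) m l → MonicSquare (p + q) m l
        square-p+q = monic-square (coprime-* (coprime-sym cop-p-p+q) (coprime-* (coprime-sym cop-q-p+q) cop-p+q-p+bq)) s≉0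
          (trans (solve 4 (λ p q r t → r :* (p :* (q :* t)) := p :* q :* r :* t) refl p q (p + q) (p + b * q)) product≈s²)
        square-p+bq : ∀ {m l} → Lead (p + b * q) m l → MonicSquare (p + b * q) m l
        square-p+bq = monic-square (coprime-* (coprime-sym cop-p-p+bq) (coprime-* (coprime-sym cop-q-p+bq) (coprime-sym cop-p+q-p+bq))) s≉0
          (trans (solve 4 (λ p q r t → t :* (p :* (q :* r)) := p :* q :* r :* t) refl p q (p + q) (p + b * q)) product≈s²)

        even : ∀ {x m l} → MonicSquare x m l → ∃ λ k → m ≡ k ℕ.+ k
        even M = MonicSquare.half M , MonicSquare.deg M

        parity : ∀ {m n} → ∃ (λ k → m ≡ k ℕ.+ k) → ∃ (λ k → n ≡ k ℕ.+ k) → n ≢ suc m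
        parity (i , ≡.refl) (j , eq) n≡1+m = odd≢even i j (≡.trans (≡.sym n≡1+m) eq)

        -- All four factors are constants times squares, hence of even degree. If deg p = deg bq,
        -- then deg p and deg q have opposite parity; if bq dominates, deg (p + bq) and deg q do.
        compare : Tri (np < suc nq) (np ≡ suc nq) (suc nq < np) → SquareSystem n
        compare (tri≈ _ np≡1+nq _) = ⊥-elim (parity (even square-q) (even square-p) np≡1+nq)
        compare (tri< np<1+nq _ _) = ⊥-elim (parity (even square-q)
          (even (square-p+bq (lead-resp (+-comm _ _) (lead-+ lead-bq lead-p np<1+nq)))) ≡.refl)
        compare (tri> _ _ 1+nq<np) = scaled-square-system bp q≉0 product≈s² lead-p 1+nq<np square-p
          (square-p+q (lead-+ lead-p lead-q (ℕ.<-trans (ℕ.n<1+n nq) 1+nq<np)))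
          (square-p+bq (lead-+ lead-p lead-bq 1+nq<np))

    -- With r₁ = A/D, r₂ = B/D, r₃ = C/D the square roots of X, X + 1, X + b, a half of the point
    -- has abscissa (r₁ + r₂)(r₁ + r₃). Since D² = (B + A)(B - A), this is (A + C)/(B - A), whose
    -- terms have degree at most k, half the degree of p.
    smaller-solution : ∀ {n} → SquareSystem n → ∃ λ m → m < n × ∃₂ λ p q → Bounded m p q
    smaller-solution {n} S = suc k ,
      -- Positivity of k gives k + 1 ≤ k + k < n.
      ℕ.≤-<-trans (≡.subst (_≤ k ℕ.+ k) (ℕ.+-comm k 1) (ℕ.+-monoʳ-≤ k k>0)) k+k<n ,
      A + C , B - A ,
      bounded
        -- For the half X₀, the same formula at the other two roots reads X₀ + 1 = (B + C)/(B - A)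
        -- and X₀ + b = (A + C)(B + C)/D²; the factor A + B clears the last denominator.
        (solution {e = A + B} {r = (A + C) * (B + C) * D} A+B≉0 (integral (integral A+C≉0 B+C≉0) D≉0)
          (begin
            (A + B) * (A + B) * ((A + C) * (B - A) * (A + C + (B - A)) * (A + C + b * (B - A)))
              ≈⟨ solve 5 (λ u v w t z → u :* u :* (v :* w :* t :* z) := u :* w :* (u :* z) :* (v :* t))
                   refl (A + B) (A + C) (B - A) (A + C + (B - A)) (A + C + b * (B - A)) ⟩
            (A + B) * (B - A) * ((A + B) * (A + C + b * (B - A))) * ((A + C) * (A + C + (B - A)))
              ≈⟨ *-cong (*-cong D²-factors cross-factors) (*-congˡ (solve 3 (λ A B C → A :+ C :+ (B :- A) := B :+ C) refl A B C)) ⟩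
            D * D * ((A + C) * (B + C)) * ((A + C) * (B + C))
              ≈⟨ solve 2 (λ D t → D :* D :* t :* t := t :* D :* (t :* D)) refl D ((A + C) * (B + C)) ⟩
            (A + C) * (B + C) * D * ((A + C) * (B + C) * D) ∎))
        (below-+ (lead⇒below lead-A (ℕ.n<1+n k)) (lead⇒below lead-C (ℕ.n<1+n k)))
        (below-+ (lead⇒below lead-B (ℕ.n<1+n k)) (below-neg (lead⇒below lead-A (ℕ.n<1+n k))))
      where
      open SquareSystem S
      D²≉0 = integral D≉0 D≉0
      D²-factors : (A + B) * (B - A) ≈ D * D
      D²-factors = combine (- 𝟙) A²+D²≈B²
        (solve 3 (λ A B D → (A :+ B) :* (B :- A) :- D :* D := (:- :1) :* (A :* A :+ D :* D :- B :* B)) refl A B D)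
      cross-factors : (A + B) * (A + C + b * (B - A)) ≈ (A + C) * (B + C)
      cross-factors = combine₂ (- b) 𝟙 A²+D²≈B² A²+bD²≈C²
        (solve 5 (λ A B C D b → (A :+ B) :* (A :+ C :+ b :* (B :- A)) :- (A :+ C) :* (B :+ C)
          := (:- b) :* (A :* A :+ D :* D :- B :* B) :+ :1 :* (A :* A :+ b :* (D :* D) :- C :* C)) refl A B C D b)
      A+B≉0 : ¬ A + B ≈ 0#
      A+B≉0 = factorˡ≉0 (λ t → D²≉0 (trans (sym D²-factors) t))
      -- Nonzero because (C - A)(A + C) = bD²; likewise (C - B)(B + C) = (b - 1)D² for the next sum.
      A+C≉0 : ¬ A + C ≈ 0#
      A+C≉0 = factorʳ≉0 {C - A} (λ t → integral b≉0 D²≉0 (trans (combine 𝟙 A²+bD²≈C²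
        (solve 4 (λ A C D b → b :* (D :* D) :- (C :- A) :* (A :+ C) := :1 :* (A :* A :+ b :* (D :* D) :- C :* C)) refl A C D b)) t))
      B+C≉0 : ¬ B + C ≈ 0#
      B+C≉0 = factorʳ≉0 {C - B} (λ t → integral b-1≉0 D²≉0 (trans (combine₂ (- 𝟙) 𝟙 A²+D²≈B² A²+bD²≈C²
        (solve 5 (λ A B C D b → (b :- :1) :* (D :* D) :- (C :- B) :* (B :+ C)
           := (:- :1) :* (A :* A :+ D :* D :- B :* B) :+ :1 :* (A :* A :+ b :* (D :* D) :- C :* C)) refl A B C D b)) t))

    descend : ∀ {n p q} → Bounded n p q → ∃ λ m → m < n × ∃₂ λ p q → Bounded m p q
    descend bd =
      let _ , _ , bd₁ , cop₁ = make-coprime bd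
          _ , _ , bd₂ , cop₂ , cop-b₂ = make-coprime-b bd₁ cop₁
          _ , _ , bd₃ , cop₃ , cop-b₃ , cop-b-1₃ = make-coprime-b-1 bd₂ cop₂ cop-b₂
      in smaller-solution (square-system bd₃ cop₃ cop-b₃ cop-b-1₃)

    -- The descent lowers n by an unknown amount, so the recursion is on the fuel `f`, of which only
    -- n ≤ f is kept.
    no-bounded-solution : ∀ f n {p q} → n ≤ f → ¬ Bounded n p q
    no-bounded-solution f n n≤f bd = continue f n≤f (descend bd)
      where
      continue : ∀ f → n ≤ f → ¬ (∃ λ m → m < n × ∃₂ λ p q → Bounded m p q)
      continue zero z≤n (_ , () , _)
      continue (suc f) n≤f (m , m<n , _ , _ , bd′) =
        no-bounded-solution f m (ℕ.≤-pred (ℕ.<-≤-trans m<n n≤f)) bd′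

-- Cauchy products of coefficient sequences

module Convolution (K : CommutativeRing 0ℓ 0ℓ) where
  open CommutativeRing K hiding (zero)
  open import Relation.Binary.Reasoning.Setoid setoid
  open import Algebra.Properties.CommutativeSemigroup +-commutativeSemigroup using (interchange; x∙yz≈y∙xz)

  private
    shift : (ℕ → Carrier) → ℕ → Carrier
    shift f i = f (suc i)

  -- The recursion peels off the lowest coefficient of f, as `_*ₚ_` peels off the head of its first
  -- argument. Working with sequences keeps trailing zeros out of the ring laws.
  conv : (ℕ → Carrier) → (ℕ → Carrier) → ℕ → Carrier
  conv f g zero    = f 0 * g 0
  conv f g (suc n) = f 0 * g (suc n) + conv (shift f) g n

  conv-cong : ∀ {f f′ g g′} → (∀ i → f i ≈ f′ i) → (∀ i → g i ≈ g′ i) → ∀ n → conv f g n ≈ conv f′ g′ n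
  conv-cong f≈ g≈ zero    = *-cong (f≈ 0) (g≈ 0)
  conv-cong f≈ g≈ (suc n) = +-cong (*-cong (f≈ 0) (g≈ (suc n))) (conv-cong (λ i → f≈ (suc i)) g≈ n)

  conv-zeroˡ : ∀ {f} g → (∀ i → f i ≈ 0#) → ∀ n → conv f g n ≈ 0#
  conv-zeroˡ g f≈0 zero    = trans (*-congʳ (f≈0 0)) (zeroˡ _)
  conv-zeroˡ g f≈0 (suc n) = trans
    (+-cong (trans (*-congʳ (f≈0 0)) (zeroˡ _)) (conv-zeroˡ g (λ i → f≈0 (suc i)) n)) (+-identityˡ 0#)

  -- The same sum opened at its other end; commutativity comes from matching the two ends.
  conv-last : ∀ f g n → conv f g (suc n) ≈ f (suc n) * g 0 + conv f (shift g) n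
  conv-last f g zero    = +-comm _ _
  conv-last f g (suc n) = trans (+-congˡ (conv-last (shift f) g n)) (x∙yz≈y∙xz _ _ _)

  conv-comm : ∀ f g n → conv f g n ≈ conv g f n
  conv-comm f g zero    = *-comm _ _
  conv-comm f g (suc n) = begin
    f 0 * g (suc n) + conv (shift f) g n   ≈⟨ +-cong (*-comm _ _) (conv-comm (shift f) g n) ⟩
    g (suc n) * f 0 + conv g (shift f) n   ≈⟨ conv-last g f n ⟨
    conv g f (suc n)                       ∎

  conv-distribʳ : ∀ f h g n → conv (λ i → f i + h i) g n ≈ conv f g n + conv h g n
  conv-distribʳ f h g zero    = distribʳ _ _ _
  conv-distribʳ f h g (suc n) =
    trans (+-cong (distribʳ _ _ _) (conv-distribʳ (shift f) (shift h) g n)) (interchange _ _ _ _)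

  conv-scale : ∀ c f g n → conv (λ i → c * f i) g n ≈ c * conv f g n
  conv-scale c f g zero    = *-assoc _ _ _
  conv-scale c f g (suc n) = trans (+-cong (*-assoc _ _ _) (conv-scale c (shift f) g n)) (sym (distribˡ _ _ _))

  conv-assoc : ∀ f g h n → conv (conv f g) h n ≈ conv f (conv g h) n
  conv-assoc f g h zero    = *-assoc _ _ _
  conv-assoc f g h (suc n) = begin
    f 0 * g 0 * h (suc n) + conv (λ i → f 0 * g (suc i) + conv (shift f) g i) h n
      ≈⟨ +-cong (*-assoc _ _ _) (conv-distribʳ (λ i → f 0 * g (suc i)) (conv (shift f) g) h n) ⟩
    f 0 * (g 0 * h (suc n)) + (conv (λ i → f 0 * g (suc i)) h n + conv (conv (shift f) g) h n)
      ≈⟨ +-congˡ (+-cong (conv-scale (f 0) (shift g) h n) (conv-assoc (shift f) g h n)) ⟩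
    f 0 * (g 0 * h (suc n)) + (f 0 * conv (shift g) h n + conv (shift f) (conv g h) n)
      ≈⟨ +-assoc _ _ _ ⟨
    f 0 * (g 0 * h (suc n)) + f 0 * conv (shift g) h n + conv (shift f) (conv g h) n
      ≈⟨ +-congʳ (distribˡ _ _ _) ⟨
    f 0 * conv g h (suc n) + conv (shift f) (conv g h) n ∎

  conv-above : ∀ n m {f g} → (∀ i → n < i → f i ≈ 0#) → (∀ i → m < i → g i ≈ 0#) →
               ∀ k → n ℕ.+ m < k → conv f g k ≈ 0#
  conv-above zero m {f} {g} f≈0 g≈0 (suc k) m<k = trans
    (+-cong (trans (*-congˡ (g≈0 (suc k) m<k)) (zeroʳ _)) (conv-zeroˡ g (λ i → f≈0 (suc i) (s≤s z≤n)) k))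
    (+-identityˡ 0#)
  conv-above (suc n) m {f} {g} f≈0 g≈0 (suc k) (s≤s n+m<k) = trans
    (+-cong (trans (*-congˡ (g≈0 (suc k) (s≤s (ℕ.≤-trans (ℕ.m≤n+m m n) (ℕ.<⇒≤ n+m<k))))) (zeroʳ _))
            (conv-above n m (λ i n<i → f≈0 (suc i) (s≤s n<i)) g≈0 k n+m<k))
    (+-identityˡ 0#)

  -- Among the products f i * g j with i + j = n + m, all but i = n have an index beyond its bound.
  conv-top : ∀ n m {f g} → (∀ i → n < i → f i ≈ 0#) → (∀ i → m < i → g i ≈ 0#) →
             conv f g (n ℕ.+ m) ≈ f n * g m
  conv-top zero zero f≈0 g≈0 = refl
  conv-top zero (suc m) {f} {g} f≈0 g≈0 =
    trans (+-congˡ (conv-zeroˡ g (λ i → f≈0 (suc i) (s≤s z≤n)) m)) (+-identityʳ _)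
  conv-top (suc n) m {f} {g} f≈0 g≈0 = trans
    (+-cong (trans (*-congˡ (g≈0 (suc (n ℕ.+ m)) (s≤s (ℕ.m≤n+m m n)))) (zeroʳ _))
            (conv-top n m (λ i n<i → f≈0 (suc i) (s≤s n<i)) g≈0))
    (+-identityˡ _)

-- Coefficient lists as the polynomial ring ℚ[a]

module Polynomials where
  open Convolution ℚ.+-*-commutativeRing

  coeff : Poly → ℕ → ℚ
  coeff []      _       = 0ℚ
  coeff (c ∷ p) zero    = c
  coeff (c ∷ p) (suc i) = coeff p i

  coeff-+ : ∀ p q i → coeff (p +ₚ q) i ≡ coeff p i ℚ.+ coeff q i
  coeff-+ []      q       i       = ≡.sym (ℚ.+-identityˡ _)
  coeff-+ (c ∷ p) []      zero    = ≡.sym (ℚ.+-identityʳ _)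
  coeff-+ (c ∷ p) []      (suc i) = ≡.sym (ℚ.+-identityʳ _)
  coeff-+ (c ∷ p) (d ∷ q) zero    = ≡.refl
  coeff-+ (c ∷ p) (d ∷ q) (suc i) = coeff-+ p q i

  coeff-scale : ∀ c p i → coeff (scaleₚ c p) i ≡ c ℚ.* coeff p i
  coeff-scale c []      i       = ≡.sym (ℚ.*-zeroʳ c)
  coeff-scale c (d ∷ p) zero    = ≡.refl
  coeff-scale c (d ∷ p) (suc i) = coeff-scale c p i

  coeff-neg : ∀ p i → coeff (negₚ p) i ≡ ℚ.- coeff p i
  coeff-neg p i = ≡.trans (coeff-scale (ℚ.- 1ℚ) p i) (-1*x≈-x (coeff p i))
    where open RingProperties ℚ.+-*-ring

  coeff-* : ∀ p q i → coeff (p *ₚ q) i ≡ conv (coeff p) (coeff q) i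
  coeff-* []      q i       = ≡.sym (conv-zeroˡ (coeff q) (λ _ → ≡.refl) i)
  coeff-* (c ∷ p) q zero    = ≡.trans (coeff-+ (scaleₚ c q) (0ℚ ∷ (p *ₚ q)) 0)
    (≡.trans (ℚ.+-identityʳ _) (coeff-scale c q 0))
  coeff-* (c ∷ p) q (suc i) = ≡.trans (coeff-+ (scaleₚ c q) (0ℚ ∷ (p *ₚ q)) (suc i))
    (≡.cong₂ ℚ._+_ (coeff-scale c q (suc i)) (coeff-* p q i))

  infix 4 _≈ₚ_
  -- Comparing coefficients identifies lists that differ by trailing zeros. As a record, it lets p
  -- and q be inferred from the type of a proof.
  record _≈ₚ_ (p q : Poly) : Set where
    constructor pointwise
    field at : ∀ i → coeff p i ≡ coeff q i
  open _≈ₚ_ public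

  zero⇒≈ : ∀ {p} → IsZeroₚ p → p ≈ₚ []
  zero⇒≈ []         = pointwise λ _ → ≡.refl
  zero⇒≈ (c≡0 ∷ p≈0) = pointwise λ { zero → c≡0 ; (suc i) → at (zero⇒≈ p≈0) i }

  ≈⇒zero : ∀ p → p ≈ₚ [] → IsZeroₚ p
  ≈⇒zero []      _ = []
  ≈⇒zero (c ∷ p) h = at h 0 ∷ ≈⇒zero p (pointwise λ i → at h (suc i))

  polyRing : CommutativeRing 0ℓ 0ℓ
  polyRing = record
    { Carrier = Poly ; _≈_ = _≈ₚ_ ; _+_ = _+ₚ_ ; _*_ = _*ₚ_ ; -_ = negₚ ; 0# = [] ; 1# = 1ℚ ∷ []
    ; isCommutativeRing = record
      { isRing = record
        { +-isAbelianGroup = record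
          { isGroup = record
            { isMonoid = record
              { isSemigroup = record
                { isMagma = record
                  { isEquivalence = record
                    { refl  = pointwise λ _ → ≡.refl
                    ; sym   = λ h → pointwise λ i → ≡.sym (at h i)
                    ; trans = λ h k → pointwise λ i → ≡.trans (at h i) (at k i)
                    }
                  ; ∙-cong = λ {p} {p′} {q} {q′} h k → via (coeff-+ p q) (coeff-+ p′ q′) λ i → ≡.cong₂ ℚ._+_ (at h i) (at k i)
                  }
                ; assoc = λ p q r → via
                    (λ i → ≡.trans (coeff-+ (p +ₚ q) r i) (≡.cong (ℚ._+ coeff r i) (coeff-+ p q i)))
                    (λ i → ≡.trans (coeff-+ p (q +ₚ r) i) (≡.cong (coeff p i ℚ.+_) (coeff-+ q r i)))
                    (λ i → ℚ.+-assoc (coeff p i) (coeff q i) (coeff r i))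
                }
              ; identity = (λ p → pointwise λ _ → ≡.refl)
                         , (λ p → via (coeff-+ p []) (λ _ → ≡.refl) (λ i → ℚ.+-identityʳ _))
              }
            ; inverse = (λ p → via (λ i → ≡.trans (coeff-+ (negₚ p) p i) (≡.cong (ℚ._+ coeff p i) (coeff-neg p i)))
                               (λ _ → ≡.refl) (λ i → ℚ.+-inverseˡ (coeff p i)))
                      , (λ p → via (λ i → ≡.trans (coeff-+ p (negₚ p) i) (≡.cong (coeff p i ℚ.+_) (coeff-neg p i)))
                               (λ _ → ≡.refl) (λ i → ℚ.+-inverseʳ (coeff p i)))
            ; ⁻¹-cong = λ {p} {q} h → via (coeff-neg p) (coeff-neg q) (λ i → ≡.cong ℚ.-_ (at h i))
            }
          ; comm = λ p q → via (coeff-+ p q) (coeff-+ q p) (λ i → ℚ.+-comm (coeff p i) (coeff q i))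
          }
        ; *-cong = λ {p} {p′} {q} {q′} h k → via (coeff-* p q) (coeff-* p′ q′) (conv-cong (at h) (at k))
        ; *-assoc = λ p q r → via
            (λ i → ≡.trans (coeff-* (p *ₚ q) r i) (conv-cong (coeff-* p q) (λ _ → ≡.refl) i))
            (λ i → ≡.trans (coeff-* p (q *ₚ r) i) (conv-cong {coeff p} (λ _ → ≡.refl) (coeff-* q r) i))
            (conv-assoc (coeff p) (coeff q) (coeff r))
        ; *-identity = *-identityˡ , (λ p → pointwise λ i → ≡.trans (at (*-comm p (1ℚ ∷ [])) i) (at (*-identityˡ p) i))
        ; distrib = (λ p q r → pointwise λ i → ≡.trans (at (*-comm p (q +ₚ r)) i) (≡.trans (at (distribʳ p q r) i)
                      (≡.trans (coeff-+ (q *ₚ p) (r *ₚ p) i) (≡.trans (≡.cong₂ ℚ._+_ (at (*-comm q p) i) (at (*-comm r p) i))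
                      (≡.sym (coeff-+ (p *ₚ q) (p *ₚ r) i))))))
                  , distribʳ
        }
      ; *-comm = *-comm
      }
    }
    where
    via : ∀ {p q} {f g : ℕ → ℚ} → (∀ i → coeff p i ≡ f i) → (∀ i → coeff q i ≡ g i) → (∀ i → f i ≡ g i) → p ≈ₚ q
    via p≡f q≡g f≡g = pointwise λ i → ≡.trans (p≡f i) (≡.trans (f≡g i) (≡.sym (q≡g i)))
    *-comm : ∀ p q → p *ₚ q ≈ₚ q *ₚ p
    *-comm p q = via (coeff-* p q) (coeff-* q p) (conv-comm (coeff p) (coeff q))
    *-identityˡ : ∀ p → (1ℚ ∷ []) *ₚ p ≈ₚ p
    *-identityˡ p = pointwise λ i → ≡.trans (coeff-+ (scaleₚ 1ℚ p) (0ℚ ∷ []) i)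
      (≡.trans (≡.cong₂ ℚ._+_ (≡.trans (coeff-scale 1ℚ p i) (ℚ.*-identityˡ (coeff p i))) (at (zero⇒≈ (≡.refl ∷ [])) i)) (ℚ.+-identityʳ (coeff p i)))
    distribʳ : ∀ r p q → (p +ₚ q) *ₚ r ≈ₚ p *ₚ r +ₚ q *ₚ r
    distribʳ r p q = via
      (λ i → ≡.trans (coeff-* (p +ₚ q) r i) (conv-cong (coeff-+ p q) (λ _ → ≡.refl) i))
      (λ i → ≡.trans (coeff-+ (p *ₚ r) (q *ₚ r) i) (≡.cong₂ ℚ._+_ (coeff-* p r i) (coeff-* q r i)))
      (conv-distribʳ (coeff p) (coeff q) (coeff r))

  open CommutativeRing polyRing using (sym; trans; +-congʳ; *-comm; zeroʳ)

  constants : ℚ.+-*-rawRing -Raw-AlmostCommutative⟶ fromCommutativeRing polyRing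
  constants = record
    { ⟦_⟧    = _∷ []
    ; +-homo = λ _ _ → pointwise λ _ → ≡.refl
    ; *-homo = λ c d → pointwise λ { zero → ≡.sym (ℚ.+-identityʳ (c ℚ.* d)) ; (suc i) → ≡.refl }
    ; -‿homo = λ c → pointwise λ { zero → ≡.sym (coeff-neg (c ∷ []) 0) ; (suc i) → ≡.refl }
    ; 0-homo = zero⇒≈ (≡.refl ∷ [])
    ; 1-homo = pointwise λ _ → ≡.refl
    }

  record Lead (p : Poly) (n : ℕ) (c : ℚ) : Set where
    constructor mkLead
    field
      top    : coeff p n ≡ c
      c≢0    : c ≢ 0ℚ
      above  : ∀ i → n < i → coeff p i ≡ 0ℚ
  open Lead

  Below : ℕ → Poly → Set
  Below n p = ∀ i → n ≤ i → coeff p i ≡ 0ℚ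

  lead? : ∀ p → p ≈ₚ [] ⊎ ∃₂ (Lead p)
  lead? [] = inj₁ (zero⇒≈ [])
  lead? (c ∷ p) with lead? p | c ℚ.≟ 0ℚ
  ... | inj₂ (n , d , l) | _       = inj₂ (suc n , d , mkLead (top l) (c≢0 l) λ { (suc i) (s≤s n<i) → above l i n<i })
  ... | inj₁ p≈0 | yes c≡0 = inj₁ (pointwise λ { zero → c≡0 ; (suc i) → at p≈0 i })
  ... | inj₁ p≈0 | no  c≢0 = inj₂ (0 , c , mkLead ≡.refl c≢0 λ { (suc i) _ → at p≈0 i })

  *-≢0 : ∀ {c d} → c ≢ 0ℚ → d ≢ 0ℚ → c ℚ.* d ≢ 0ℚ
  *-≢0 {c} {d} c≢0 d≢0 cd≡0 = d≢0 (begin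
    d                        ≡⟨ ℚ.*-identityˡ d ⟨
    1ℚ ℚ.* d                 ≡⟨ ≡.cong (ℚ._* d) (ℚ.*-inverseˡ c) ⟨
    (ℚ.1/ c) ℚ.* c ℚ.* d     ≡⟨ ℚ.*-assoc (ℚ.1/ c) c d ⟩
    (ℚ.1/ c) ℚ.* (c ℚ.* d)   ≡⟨ ≡.cong ((ℚ.1/ c) ℚ.*_) cd≡0 ⟩
    (ℚ.1/ c) ℚ.* 0ℚ          ≡⟨ ℚ.*-zeroʳ (ℚ.1/ c) ⟩
    0ℚ                       ∎)
    where
    open ≡.≡-Reasoning
    instance _ = ℚ.≢-nonZero c≢0

  lead-unique : ∀ {p n m c d} → Lead p n c → Lead p m d → n ≡ m × c ≡ d
  lead-unique {p} {n} {m} l k = n≡m (ℕ.<-cmp n m) , ≡.trans (≡.sym (top l)) (≡.trans (≡.cong (coeff p) (n≡m (ℕ.<-cmp n m))) (top k))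
    where
    n≡m : Tri (n < m) (n ≡ m) (m < n) → n ≡ m
    n≡m (tri< n<m _ _) = ⊥-elim (c≢0 k (≡.trans (≡.sym (top k)) (above l m n<m)))
    n≡m (tri≈ _ n≡m _) = n≡m
    n≡m (tri> _ _ m<n) = ⊥-elim (c≢0 l (≡.trans (≡.sym (top l)) (above k n m<n)))

  lead-* : ∀ {p q n m c d} → Lead p n c → Lead q m d → Lead (p *ₚ q) (n ℕ.+ m) (c ℚ.* d)
  lead-* {p} {q} {n} {m} l k = mkLead
    (≡.trans (coeff-* p q (n ℕ.+ m)) (≡.trans (conv-top n m (above l) (above k)) (≡.cong₂ ℚ._*_ (top l) (top k))))
    (*-≢0 (c≢0 l) (c≢0 k))
    λ i n+m<i → ≡.trans (coeff-* p q i) (conv-above n m (above l) (above k) i n+m<i)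

  below-+ : ∀ {n p q} → Below n p → Below n q → Below n (p +ₚ q)
  below-+ {n} {p} {q} bp bq i n≤i =
    ≡.trans (coeff-+ p q i) (≡.trans (≡.cong₂ ℚ._+_ (bp i n≤i) (bq i n≤i)) (ℚ.+-identityˡ 0ℚ))

  lead-+ : ∀ {p q n m c d} → Lead p n c → Lead q m d → m < n → Lead (p +ₚ q) n c
  lead-+ {p} {q} {n} l k m<n = mkLead
    (≡.trans (coeff-+ p q n) (≡.trans (≡.cong₂ ℚ._+_ (top l) (above k n m<n)) (ℚ.+-identityʳ _)))
    (c≢0 l)
    (below-+ {suc n} {p} {q} (above l) (λ i n<i → above k i (ℕ.<-trans m<n n<i)))

  below-neg : ∀ {n p} → Below n p → Below n (negₚ p)
  below-neg {p = p} bl i n≤i = ≡.trans (coeff-neg p i) (≡.cong ℚ.-_ (bl i n≤i))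

  below-suc : ∀ {n p} → Below (suc n) p → Below n p ⊎ ∃ (Lead p n)
  below-suc {n} {p} bl with coeff p n ℚ.≟ 0ℚ
  ... | no  ≢0 = inj₂ (coeff p n , mkLead ≡.refl ≢0 bl)
  ... | yes ≡0 = inj₁ below
    where
    below : Below n p
    below i n≤i with ℕ.m≤n⇒m<n∨m≡n n≤i
    ... | inj₁ n<i    = bl i n<i
    ... | inj₂ ≡.refl = ≡0

  -- Recursion in the style of Horner: from x = yk + r follows c + ax = y(ak) + (c + ar). The last
  -- term has degree at most m, and subtracting t y removes its coefficient in degree m.
  division : ∀ {y m d} → Lead y m d → ∀ x → ∃₂ λ k r → x ≈ₚ y *ₚ k +ₚ r × Below m r
  division {y} l [] = [] , [] , sym (trans (+-congʳ {[]} (zeroʳ y)) (zero⇒≈ [])) , λ _ _ → ≡.refl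
  division {y} {m} {d} l (c ∷ x) = step (division l x)
    where
    instance _ = ℚ.≢-nonZero (c≢0 l)
    step : (∃₂ λ k r → x ≈ₚ y *ₚ k +ₚ r × Below m r) → ∃₂ λ k r → c ∷ x ≈ₚ y *ₚ k +ₚ r × Below m r
    step (k , r , x≈yk+r , bl) = t ∷ k , r′ , eq , below
      where
      open ℚ-Algebra polyRing constants using (solve; _:=_; _:+_; _:-_)
      t : ℚ
      t = coeff (c ∷ r) m ℚ.* ℚ.1/ d
      r′ : Poly
      r′ = (c ∷ r) +ₚ negₚ (scaleₚ t y)
      td : t ℚ.* d ≡ coeff (c ∷ r) m
      td = ≡.trans (ℚ.*-assoc (coeff (c ∷ r) m) (ℚ.1/ d) d)
        (≡.trans (≡.cong (coeff (c ∷ r) m ℚ.*_) (ℚ.*-inverseˡ d)) (ℚ.*-identityʳ (coeff (c ∷ r) m)))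
      shifted : c ∷ x ≈ₚ (0ℚ ∷ (k *ₚ y)) +ₚ (c ∷ r)
      shifted = pointwise λ
        { zero → ≡.sym (ℚ.+-identityˡ c)
        ; (suc i) → at (trans x≈yk+r (+-congʳ {r} (*-comm y k))) i }
      eq : c ∷ x ≈ₚ y *ₚ (t ∷ k) +ₚ r′
      eq = trans shifted (trans
        (solve 3 (λ u v w → v :+ w := u :+ v :+ (w :- u)) (CommutativeRing.refl polyRing)
          (scaleₚ t y) (0ℚ ∷ (k *ₚ y)) (c ∷ r))
        (+-congʳ {r′} (*-comm (t ∷ k) y)))
      coeff-r′ : ∀ i → coeff r′ i ≡ coeff (c ∷ r) i ℚ.- t ℚ.* coeff y i
      coeff-r′ i = ≡.trans (coeff-+ (c ∷ r) (negₚ (scaleₚ t y)) i) (≡.cong (coeff (c ∷ r) i ℚ.+_)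
        (≡.trans (coeff-neg (scaleₚ t y) i) (≡.cong ℚ.-_ (coeff-scale t y i))))
      cancel : ∀ {u v} → u ≡ v → u ℚ.- v ≡ 0ℚ
      cancel {u} ≡.refl = ℚ.+-inverseʳ u
      high : ∀ i → m < i → coeff (c ∷ r) i ≡ 0ℚ
      high (suc i) (s≤s m≤i) = bl i m≤i
      below : Below m r′
      below i m≤i with ℕ.m≤n⇒m<n∨m≡n m≤i
      ... | inj₂ ≡.refl = ≡.trans (coeff-r′ m) (cancel (≡.trans (≡.sym td) (≡.cong (t ℚ.*_) (≡.sym (top l)))))
      ... | inj₁ m<i = ≡.trans (coeff-r′ i) (cancel (≡.trans (high i m<i)
              (≡.sym (≡.trans (≡.cong (t ℚ.*_) (above l i m<i)) (ℚ.*-zeroʳ t)))))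

  ℚ[a] : PolynomialDomain
  ℚ[a] = record
    { ring        = polyRing
    ; morphism    = constants
    ; Lead        = Lead
    ; lead?       = lead?
    ; lead-resp   = λ {_} {_} {n} x≈y l → mkLead (≡.trans (≡.sym (at x≈y n)) (top l)) (c≢0 l)
                      λ i n<i → ≡.trans (≡.sym (at x≈y i)) (above l i n<i)
    ; lead≉0      = λ {_} {n} l x≈0 → c≢0 l (≡.trans (≡.sym (top l)) (at x≈0 n))
    ; lead-unique = lead-unique
    ; lead-*      = lead-*
    ; lead-+      = lead-+
    ; lead-0      = λ l → pointwise λ { zero → top l ; (suc i) → above l (suc i) (s≤s z≤n) }
    ; const-lead  = λ c≢0 → mkLead ≡.refl c≢0 λ { (suc i) _ → ≡.refl }
    ; lead-≢0     = c≢0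
    ; Below       = Below
    ; below-resp  = λ x≈y bl i n≤i → ≡.trans (≡.sym (at x≈y i)) (bl i n≤i)
    ; below-0#    = λ _ _ → ≡.refl
    ; below-+     = λ {n} {x} {y} → below-+ {n} {x} {y}
    ; below-neg   = λ {n} {x} → below-neg {n} {x}
    ; lead⇒below  = λ l n<m i m≤i → above l i (ℕ.<-≤-trans n<m m≤i)
    ; below⇒lead< = λ {n} {m} bl l → ℕ.≰⇒> λ m≤n → c≢0 l (≡.trans (≡.sym (top l)) (bl n m≤n))
    ; below-0     = λ bl → pointwise λ i → bl i z≤n
    ; below-suc   = λ {n} {x} → below-suc {n} {x}
    ; division    = division
    }

-- Rational points of y² = X ((b - X)² + 4X)

module RationalPoints (P : PolynomialDomain) where
  open PolynomialDomain P
  open LegendreDescent P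
  open CommutativeRing ring using (*-cong; *-congˡ; *-congʳ; +-cong; +-congˡ; -‿cong; zeroˡ; zeroʳ; *-comm)

  module _ {b β γ δ}
    (lead-b : Lead b 1 β) (lead-b-1 : Lead (b - 𝟙) 1 γ) (lead-1-b : Lead (- (b - 𝟙)) 1 δ) where

    no-solution : ∀ {p q} → ¬ Solution lead-b lead-b-1 p q
    no-solution {p} {q} s = bounded-below (lead-of p≉0) (lead-of q≉0)
      where
      open Solution s
      bounded-below : ∃₂ (Lead p) → ∃₂ (Lead q) → ⊥
      bounded-below (n , _ , lp) (m , _ , lq) = no-bounded-solution lead-b lead-b-1 _ (suc (n ℕ.+ m)) ℕ.≤-refl
        (bounded s (lead⇒below lp (s≤s (ℕ.m≤m+n n m))) (lead⇒below lq (s≤s (ℕ.m≤n+m m n))))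

    -- The degree of u² is even, that of (1 - b)v² odd.
    1-b-nonsquare : ∀ {u v} → ¬ v ≈ 0# → ¬ u * u ≈ - (b - 𝟙) * (v * v)
    1-b-nonsquare {u} {v} v≉0 u²≈ = parity (lead-of u≉0) (lead-of v≉0)
      where
      u≉0 : ¬ u ≈ 0#
      u≉0 = factorˡ≉0 (λ t → integral (lead≉0 lead-1-b) (integral v≉0 v≉0) (trans (sym u²≈) t))
      parity : ∃₂ (Lead u) → ∃₂ (Lead v) → ⊥
      parity (n , _ , lu) (m , _ , lv) = odd≢even m n (≡.sym (proj₁ (lead-unique
        (lead-* lu lu) (lead-resp (sym u²≈) (lead-* lead-1-b (lead-* lv lv))))))

    :2 :4 : ∀ {n} → Polynomial n
    :2 = con (+ 2 ℚ./ 1)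
    :4 = con (+ 4 ℚ./ 1)

    𝟚 𝟜 : Carrier
    𝟚 = const (+ 2 ℚ./ 1)
    𝟜 = const (+ 4 ℚ./ 1)

    -- Homogenised in X and z: the abscissa is X/z and the ordinate y/w, each with its own
    -- denominator.
    cubic : Carrier → Carrier → Carrier
    cubic X z = X * ((b * z - X) * (b * z - X) + 𝟜 * X * z)

    cubic-cong : ∀ {X Y} z → X ≈ Y → cubic X z ≈ cubic Y z
    cubic-cong z X≈Y = *-cong X≈Y (+-cong (*-cong f≈ f≈) (*-congʳ (*-congˡ X≈Y)))
      where f≈ = +-congˡ (-‿cong X≈Y)

    -- The isogeny sends X / z to (b z - X)² / (4 X z).
    no-generic-point : ∀ {X z y w} → ¬ X ≈ 0# → ¬ z ≈ 0# → ¬ w ≈ 0# →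
      ¬ b * z - X ≈ 0# → ¬ (b * z - X) * (b * z - X) + 𝟜 * X * z ≈ 0# → ¬ b * z + X ≈ 0# →
      ¬ y * y * (z * z * z) ≈ cubic X z * (w * w)
    no-generic-point {X} {z} {y} {w} X≉0 z≉0 w≉0 f≉0 g≉0 h≉0 eqn = no-solution
      -- Here p + q is g and p + bq is h², so modulo squares the quartic is X z g, which the curve
      -- equation makes a square.
      (solution {p = f * f} {q = 𝟜 * X * z} {e = w} {r = 𝟚 * f * z * z * y * h} w≉0 r≉0 (begin
        w * w * (f * f * (𝟜 * X * z) * g * (f * f + b * (𝟜 * X * z)))
          ≈⟨ *-congˡ (*-congˡ (solve 3 (λ b z X → (b :* z :- X) :* (b :* z :- X) :+ b :* (:4 :* X :* z)
               := (b :* z :+ X) :* (b :* z :+ X)) refl b z X)) ⟩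
        w * w * (f * f * (𝟜 * X * z) * g * (h * h))
          ≈⟨ solve 6 (λ w f X z g h → w :* w :* (f :* f :* (:4 :* X :* z) :* g :* (h :* h))
               := :4 :* f :* f :* z :* (h :* h) :* (X :* g :* (w :* w))) refl w f X z g h ⟩
        𝟜 * f * f * z * (h * h) * (X * g * (w * w))
          ≈⟨ *-congˡ eqn ⟨
        𝟜 * f * f * z * (h * h) * (y * y * (z * z * z))
          ≈⟨ solve 4 (λ f z y h → :4 :* f :* f :* z :* (h :* h) :* (y :* y :* (z :* z :* z))
               := :2 :* f :* z :* z :* y :* h :* (:2 :* f :* z :* z :* y :* h)) refl f z y h ⟩
        𝟚 * f * z * z * y * h * (𝟚 * f * z * z * y * h) ∎))
      where
      f = b * z - X
      g = f * f + 𝟜 * X * z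
      h = b * z + X
      y≉0 : ¬ y ≈ 0#
      y≉0 = factorˡ≉0 (factorˡ≉0 (λ t → integral (integral X≉0 g≉0) (integral w≉0 w≉0) (trans (sym eqn) t)))
      𝟚≉0 : ¬ 𝟚 ≈ 0#
      𝟚≉0 = lead≉0 (const-lead (λ ()))
      r≉0 : ¬ 𝟚 * f * z * z * y * h ≈ 0#
      r≉0 = integral (integral (integral (integral (integral 𝟚≉0 f≉0) z≉0) z≉0) y≉0) h≉0

    -- The isogeny sends a point to 2-torsion exactly when X or one of the factors in
    -- `no-generic-point` vanishes. X = 0 is the 2-torsion point, X = bz gives two opposite points,
    -- and the other two cases make 1 - b a square.
    classify : ∀ {X z y w} → ¬ z ≈ 0# → ¬ w ≈ 0# → y * y * (z * z * z) ≈ cubic X z * (w * w) →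
      (X ≈ 0# × y ≈ 0#) ⊎ (X ≈ b * z × (y ≈ 𝟚 * b * w ⊎ y ≈ - (𝟚 * b * w)))
    classify {X} {z} {y} {w} z≉0 w≉0 eqn =
      cases (X ≟0) ((b * z - X) ≟0) (((b * z - X) * (b * z - X) + 𝟜 * X * z) ≟0) ((b * z + X) ≟0)
      where
      z³≉0 : ¬ z * z * z ≈ 0#
      z³≉0 = integral (integral z≉0 z≉0) z≉0
      zero-product : ∀ {s t} → s * t ≈ 0# → s ≈ 0# ⊎ t ≈ 0#
      zero-product {s} {t} st≈0 with s ≟0 | t ≟0
      ... | yes s≈0 | _       = inj₁ s≈0
      ... | no  _   | yes t≈0 = inj₂ t≈0
      ... | no  s≉0 | no  t≉0 = ⊥-elim (integral s≉0 t≉0 st≈0)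

      y-zero : X ≈ 0# → y ≈ 0#
      y-zero X≈0 = fromSquare (y ≟0)
        where
        fromSquare : Dec (y ≈ 0#) → y ≈ 0#
        fromSquare (yes y≈0) = y≈0
        fromSquare (no  y≉0) = ⊥-elim (integral (integral y≉0 y≉0) z³≉0
          (trans eqn (trans (*-congʳ (trans (*-congʳ X≈0) (zeroˡ _))) (zeroˡ _))))

      y-value : X ≈ b * z → y ≈ 𝟚 * b * w ⊎ y ≈ - (𝟚 * b * w)
      y-value X≈bz = signs (zero-product (*-cancelˡ z³≉0 (begin
        z * z * z * ((y - 𝟚 * b * w) * (y + 𝟚 * b * w))
          ≈⟨ solve 4 (λ b z y w → z :* z :* z :* ((y :- :2 :* b :* w) :* (y :+ :2 :* b :* w))
               := y :* y :* (z :* z :* z)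
                  :- (b :* z) :* ((b :* z :- b :* z) :* (b :* z :- b :* z) :+ :4 :* (b :* z) :* z) :* (w :* w)) refl b z y w ⟩
        y * y * (z * z * z) - cubic (b * z) z * (w * w) ≈⟨ +-congˡ (-‿cong (*-congʳ (cubic-cong z X≈bz))) ⟨
        y * y * (z * z * z) - cubic X z * (w * w)       ≈⟨ x≈y⇒x-y≈0 eqn ⟩
        0#                                              ≈⟨ zeroʳ _ ⟨
        z * z * z * 0#                                  ∎)))
        where
        signs : y - 𝟚 * b * w ≈ 0# ⊎ y + 𝟚 * b * w ≈ 0# → y ≈ 𝟚 * b * w ⊎ y ≈ - (𝟚 * b * w)
        signs (inj₁ h) = inj₁ (x-y≈0⇒x≈y h)
        signs (inj₂ h) = inj₂ (x-y≈0⇒x≈y (trans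
          (solve 2 (λ y t → y :- (:- t) := y :+ t) refl y (𝟚 * b * w)) h))

      cases : Dec (X ≈ 0#) → Dec (b * z - X ≈ 0#) → Dec ((b * z - X) * (b * z - X) + 𝟜 * X * z ≈ 0#) →
              Dec (b * z + X ≈ 0#) → _
      cases (yes X≈0) _ _ _ = inj₁ (X≈0 , y-zero X≈0)
      cases (no _) (yes f≈0) _ _ = inj₂ (X≈bz , y-value X≈bz)
        where X≈bz = sym (x-y≈0⇒x≈y f≈0)
      -- Completing the square: (b - X)² + 4X = (b - X - 2)² - 4(1 - b).
      cases (no _) (no _) (yes g≈0) _ = ⊥-elim (1-b-nonsquare
        {b * z - X - 𝟚 * z} {𝟚 * z} (integral (lead≉0 (const-lead (λ ()))) z≉0)
        (x-y≈0⇒x≈y (trans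
          (solve 3 (λ b z X → (b :* z :- X :- :2 :* z) :* (b :* z :- X :- :2 :* z) :- (:- (b :- :1)) :* (:2 :* z :* (:2 :* z))
            := (b :* z :- X) :* (b :* z :- X) :+ :4 :* X :* z) refl b z X)
          g≈0)))
      -- At X = -b the cubic takes the value 4b²(1 - b).
      cases (no _) (no _) (no _) (yes h≈0) = ⊥-elim (1-b-nonsquare
        {y} {𝟚 * b * w} (integral (integral (lead≉0 (const-lead (λ ()))) (lead≉0 lead-b)) w≉0)
        (*-cancelˡ z³≉0 (begin
          z * z * z * (y * y)           ≈⟨ *-comm _ _ ⟩
          y * y * (z * z * z)           ≈⟨ eqn ⟩
          cubic X z * (w * w)           ≈⟨ *-congʳ (cubic-cong z X≈-bz) ⟩
          cubic (- (b * z)) z * (w * w)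
            ≈⟨ solve 3 (λ b z w → (:- (b :* z)) :* ((b :* z :- (:- (b :* z))) :* (b :* z :- (:- (b :* z))) :+ :4 :* (:- (b :* z)) :* z) :* (w :* w)
                 := z :* z :* z :* ((:- (b :- :1)) :* (:2 :* b :* w :* (:2 :* b :* w)))) refl b z w ⟩
          z * z * z * (- (b - 𝟙) * (𝟚 * b * w * (𝟚 * b * w))) ∎)))
        where
        X≈-bz : X ≈ - (b * z)
        X≈-bz = x-y≈0⇒x≈y (trans (solve 2 (λ X t → X :- (:- t) := t :+ X) refl X (b * z)) h≈0)
      cases (no X≉0) (no f≉0) (no g≉0) (no h≉0) = ⊥-elim (no-generic-point X≉0 z≉0 w≉0 f≉0 g≉0 h≉0 eqn)

-- Arithmetic of unreduced fractions

module Fractions where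
  open Polynomials using (zero⇒≈; ≈⇒zero; ℚ[a])
  open PolynomialDomain ℚ[a]
  open CommutativeRing ring using (*-cong; *-congˡ; *-congʳ; +-cong; +-congˡ; -‿cong; *-assoc)

  infix 4 _≃_
  record _≃_ (f g : Fn) : Set where
    constructor cross
    field cross-eq : num f * den g ≈ num g * den f
  open _≃_ public

  ≈F⇒≃ : ∀ {f g} → f ≈F g → f ≃ g
  ≈F⇒≃ {f} {g} h = cross (x-y≈0⇒x≈y (trans
    (solve 4 (λ a b c d → a :* b :- c :* d := a :* b :+ (con (ℚ.- 1ℚ) :* c) :* d) refl (num f) (den g) (num g) (den f))
    (trans (+-congˡ (*-congʳ (-1*≈neg (num g)))) (zero⇒≈ h))))
    where
    -1*≈neg : ∀ p → const (ℚ.- 1ℚ) * p ≈ - p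
    -1*≈neg p = solve 1 (λ p → con (ℚ.- 1ℚ) :* p := :- p) refl p

  ≃⇒≈F : ∀ {f g} → f ≃ g → f ≈F g
  ≃⇒≈F {f} {g} (cross h) = ≈⇒zero _ (trans
    (solve 4 (λ a b c d → a :* b :+ (:- c) :* d := a :* b :- c :* d) refl (num f) (den g) (num g) (den f))
    (x≈y⇒x-y≈0 h))

  ≃-* : ∀ {f g n d n′ d′} → f ≃ n // d → g ≃ n′ // d′ → f *F g ≃ (n * n′) // (d * d′)
  ≃-* {f} {g} {n} {d} {n′} {d′} (cross h) (cross k) = cross (begin
    num f * num g * (d * d′)       ≈⟨ solve 4 (λ a b c d → a :* b :* (c :* d) := a :* c :* (b :* d)) refl (num f) (num g) d d′ ⟩
    num f * d * (num g * d′)       ≈⟨ *-cong h k ⟩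
    n * den f * (n′ * den g)       ≈⟨ solve 4 (λ a b c d → a :* b :* (c :* d) := a :* c :* (b :* d)) refl n (den f) n′ (den g) ⟩
    n * n′ * (den f * den g)       ∎)

  ≃-+ : ∀ {f g n n′ d} → f ≃ n // d → g ≃ n′ // d → f +F g ≃ (n + n′) // d
  ≃-+ {f} {g} {n} {n′} {d} (cross h) (cross k) = cross (begin
    (num f * den g + num g * den f) * d
      ≈⟨ solve 5 (λ a b c e d → (a :* b :+ c :* e) :* d := a :* d :* b :+ c :* d :* e) refl (num f) (den g) (num g) (den f) d ⟩
    num f * d * den g + num g * d * den f
      ≈⟨ +-cong (*-congʳ h) (*-congʳ k) ⟩
    n * den f * den g + n′ * den g * den f
      ≈⟨ solve 4 (λ a b c d → a :* c :* d :+ b :* d :* c := (a :+ b) :* (c :* d)) refl n n′ (den f) (den g) ⟩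
    (n + n′) * (den f * den g) ∎)

  ≃-expand : ∀ {f n d n′ d′} e → n * e ≈ n′ → d * e ≈ d′ → f ≃ n // d → f ≃ n′ // d′
  ≃-expand {f} {n} {d} {n′} {d′} e ne≈ de≈ (cross h) = cross (begin
    num f * d′          ≈⟨ *-congˡ {num f} de≈ ⟨
    num f * (d * e)     ≈⟨ *-assoc (num f) d e ⟨
    num f * d * e       ≈⟨ *-congʳ h ⟩
    n * den f * e       ≈⟨ solve 3 (λ a b c → a :* b :* c := a :* c :* b) refl n (den f) e ⟩
    n * e * den f       ≈⟨ *-congʳ ne≈ ⟩
    n′ * den f          ∎)

  ≃-trans : ∀ {f g h} → ¬ den g ≈ 0# → f ≃ g → g ≃ h → f ≃ h
  ≃-trans {f} {g} {h} d≉0 (cross fg) (cross gh) = cross (*-cancelˡ d≉0 (begin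
    den g * (num f * den h)   ≈⟨ solve 3 (λ d n e → d :* (n :* e) := n :* d :* e) refl (den g) (num f) (den h) ⟩
    num f * den g * den h     ≈⟨ *-congʳ fg ⟩
    num g * den f * den h     ≈⟨ solve 3 (λ a b c → a :* b :* c := a :* c :* b) refl (num g) (den f) (den h) ⟩
    num g * den h * den f     ≈⟨ *-congʳ gh ⟩
    num h * den g * den f     ≈⟨ solve 3 (λ a b c → a :* b :* c := b :* (a :* c)) refl (num h) (den g) (den f) ⟩
    den g * (num h * den f)   ∎))

  -- f ⇓ p: the fraction f is the polynomial p.
  infix 4 _⇓_
  record _⇓_ (f : Fn) (p : Poly) : Set where
    constructor value
    field
      den≉0 : ¬ den f ≈ 0#
      num≈  : num f ≈ p * den f
  open _⇓_ public

  const-⇓ : ∀ c → constF c ⇓ const c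
  const-⇓ c = value (lead≉0 (const-lead (λ ()))) (solve 1 (λ t → t := t :* :1) refl (const c))

  ⇓-resp : ∀ {f p q} → p ≈ q → f ⇓ p → f ⇓ q
  ⇓-resp p≈q (value d h) = value d (trans h (*-congʳ p≈q))

  ⇓-+ : ∀ {f g p q} → f ⇓ p → g ⇓ q → f +F g ⇓ p + q
  ⇓-+ {f} {g} {p} {q} (value d h) (value e k) = value (integral d e) (trans
    (+-cong (*-congʳ h) (*-congʳ k))
    (solve 4 (λ p q d e → p :* d :* e :+ q :* e :* d := (p :+ q) :* (d :* e)) refl p q (den f) (den g)))

  ⇓-* : ∀ {f g p q} → f ⇓ p → g ⇓ q → f *F g ⇓ p * q
  ⇓-* {f} {g} {p} {q} (value d h) (value e k) = value (integral d e) (trans (*-cong h k)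
    (solve 4 (λ p q d e → p :* d :* (q :* e) := p :* q :* (d :* e)) refl p q (den f) (den g)))

  ⇓-neg : ∀ {f p} → f ⇓ p → negF f ⇓ - p
  ⇓-neg {f} {p} (value d h) = value d (trans (-‿cong h)
    (solve 2 (λ p d → :- (p :* d) := (:- p) :* d) refl p (den f)))

  ⇓-- : ∀ {f g p q} → f ⇓ p → g ⇓ q → f -F g ⇓ p - q
  ⇓-- u v = ⇓-+ u (⇓-neg v)

  ⇓-/ : ∀ {f g p q} r → ¬ q ≈ 0# → p ≈ r * q → f ⇓ p → g ⇓ q → f /F g ⇓ r
  ⇓-/ {f} {n // d} {p} {q} r q≉0 p≈rq (value f≉0 h) (value d≉0 k) with isZeroₚ? n
  -- The default inverse 0 cannot arise, since n = q d with q and d nonzero.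
  ... | yes n≈0 = ⊥-elim (integral q≉0 d≉0 (trans (sym k) (zero⇒≈ n≈0)))
  ... | no  n≉0 = value (integral f≉0 (λ t → n≉0 (≈⇒zero n t))) (begin
    num f * d                 ≈⟨ *-congʳ (trans h (*-congʳ p≈rq)) ⟩
    r * q * den f * d         ≈⟨ solve 4 (λ r q f d → r :* q :* f :* d := r :* (f :* (q :* d))) refl r q (den f) d ⟩
    r * (den f * (q * d))     ≈⟨ *-congˡ {r} (*-congˡ {den f} k) ⟨
    r * (den f * n)           ∎)

  ⇓⇒≃ : ∀ {f p} → f ⇓ p → f ≃ p // 𝟙
  ⇓⇒≃ {f} (value _ h) = cross (trans (solve 1 (λ n → n :* :1 := n) refl (num f)) h)

  ⇓⇒≈F : ∀ {f g p q} → p ≈ q → f ⇓ p → g ⇓ q → f ≈F g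
  ⇓⇒≈F {f} {g} {p} {q} p≈q (value _ h) (value _ k) = ≃⇒≈F {f} {g} (cross (begin
    num f * den g       ≈⟨ *-congʳ (trans h (*-congʳ p≈q)) ⟩
    q * den f * den g   ≈⟨ solve 3 (λ q d e → q :* d :* e := q :* e :* d) refl q (den f) (den g) ⟩
    q * den g * den f   ≈⟨ *-congʳ k ⟨
    num g * den f       ∎))

  ≈F⇒≈ : ∀ {f g p q} → f ⇓ p → g ⇓ q → f ≈F g → p ≈ q
  ≈F⇒≈ {f} {g} {p} {q} (value d h) (value e k) f≈g = *-cancelˡ (integral d e) (begin
    den f * den g * p   ≈⟨ solve 3 (λ p d e → d :* e :* p := p :* d :* e) refl p (den f) (den g) ⟩
    p * den f * den g   ≈⟨ *-congʳ h ⟨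
    num f * den g       ≈⟨ cross-eq (≈F⇒≃ {f} {g} f≈g) ⟩
    num g * den f       ≈⟨ *-congʳ k ⟩
    q * den g * den f   ≈⟨ solve 3 (λ q d e → q :* e :* d := d :* e :* q) refl q (den f) (den g) ⟩
    den f * den g * q   ∎)

  :2 :3 :4 :8 :16 :64 : ∀ {n} → Polynomial n
  :2  = con (+ 2 ℚ./ 1)
  :3  = con (+ 3 ℚ./ 1)
  :4  = con (+ 4 ℚ./ 1)
  :8  = con (+ 8 ℚ./ 1)
  :16 = con (+ 16 ℚ./ 1)
  :64 = con (+ 64 ℚ./ 1)

  𝟚 𝟛 a b A B C : Poly
  𝟚 = const (+ 2 ℚ./ 1)
  𝟛 = const (+ 3 ℚ./ 1)
  a = 0ℚ ∷ 1ℚ ∷ []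
  b = const (+ 4 ℚ./ 1) * a + 𝟙
  A = const (+ 4 ℚ./ 1) * a - 𝟙
  B = const (+ 16 ℚ./ 1) * a
  C = const (+ 64 ℚ./ 1) * a * a - const (+ 16 ℚ./ 1) * a

  𝟚≉0 : ¬ 𝟚 ≈ 0#
  𝟚≉0 = lead≉0 (const-lead {+ 2 ℚ./ 1} (λ ()))

  varA-⇓ : varA ⇓ a
  varA-⇓ = value (lead≉0 (const-lead (λ ()))) (solve 1 (λ t → t := t :* :1) refl a)

  coefA-⇓ : coefA ⇓ A
  coefA-⇓ = ⇓-- (⇓-* (const-⇓ (+ 4 ℚ./ 1)) varA-⇓) (const-⇓ 1ℚ)

  coefB-⇓ : coefB ⇓ B
  coefB-⇓ = ⇓-* (const-⇓ (+ 16 ℚ./ 1)) varA-⇓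

  coefC-⇓ : coefC ⇓ C
  coefC-⇓ = ⇓-- (⇓-* (⇓-* (const-⇓ (+ 64 ℚ./ 1)) varA-⇓) varA-⇓) (⇓-* (const-⇓ (+ 16 ℚ./ 1)) varA-⇓)

  lead-b : Lead b 1 (+ 4 ℚ./ 1)
  lead-b = Polynomials.mkLead ≡.refl (λ ()) λ { (suc (suc i)) _ → ≡.refl ; (suc zero) (s≤s ()) }

  lead-b-1 : Lead (b - 𝟙) 1 (+ 4 ℚ./ 1)
  lead-b-1 = Polynomials.mkLead ≡.refl (λ ()) λ { (suc (suc i)) _ → ≡.refl ; (suc zero) (s≤s ()) }

  lead-1-b : Lead (- (b - 𝟙)) 1 (ℚ.- (+ 4 ℚ./ 1))
  lead-1-b = Polynomials.mkLead ≡.refl (λ ()) λ { (suc (suc i)) _ → ≡.refl ; (suc zero) (s≤s ()) }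

  -- The Weierstrass equation over ℚ(a)

  module Points = RationalPoints ℚ[a]

  cubic : Poly → Poly → Poly
  cubic = Points.cubic lead-b lead-b-1 lead-1-b

  weierstrass : Fn → Fn
  weierstrass x = (x *F x *F x) +F (coefA *F x *F x) +F (coefB *F x) +F coefC

  module _ {xn xd yn yd : Poly} (xd≉0 : ¬ xd ≈ 0#) (yd≉0 : ¬ yd ≈ 0#) where
    private
      x y : Fn
      x = xn // xd
      y = yn // yd
      X cube : Poly
      -- X / xd is x + b - 2, because b - 2 = 4a - 1 = A.
      X = xn + A * xd
      cube = xd * xd * xd

    -- Operations on `Fn` never reduce, so each summand is first brought to the denominator xd³;
    -- what remains is one identity between numerators.
    weierstrass≃ : weierstrass x ≃ cubic X xd // cube
    weierstrass≃ = ≃-expand 𝟙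
      (solve 3 (λ a n d →
        (n :* n :* n :+ (:4 :* a :- :1) :* n :* n :* d :+ :16 :* a :* n :* (d :* d)
          :+ (:64 :* a :* a :- :16 :* a) :* (d :* d :* d)) :* :1
        := (n :+ (:4 :* a :- :1) :* d) :*
           (((:4 :* a :+ :1) :* d :- (n :+ (:4 :* a :- :1) :* d)) :* ((:4 :* a :+ :1) :* d :- (n :+ (:4 :* a :- :1) :* d))
            :+ :4 :* (n :+ (:4 :* a :- :1) :* d) :* d))
        refl a xn xd)
      (solve 1 (λ d → d :* :1 := d) refl cube)
      (≃-+ (≃-+ (≃-+ cubic-term quadratic-term) linear-term) constant-term)
      where
      x≃ : x ≃ xn // xd
      x≃ = cross refl
      cubic-term : x *F x *F x ≃ (xn * xn * xn) // cube
      cubic-term = cross refl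
      quadratic-term : coefA *F x *F x ≃ (A * xn * xn * xd) // cube
      quadratic-term = ≃-expand xd refl
        (solve 1 (λ d → :1 :* d :* d :* d := d :* d :* d) refl xd) (≃-* (≃-* (⇓⇒≃ coefA-⇓) x≃) x≃)
      linear-term : coefB *F x ≃ (B * xn * (xd * xd)) // cube
      linear-term = ≃-expand (xd * xd) refl
        (solve 1 (λ d → :1 :* d :* (d :* d) := d :* d :* d) refl xd) (≃-* (⇓⇒≃ coefB-⇓) x≃)
      constant-term : coefC ≃ (C * cube) // cube
      constant-term = ≃-expand cube refl (solve 1 (λ d → :1 :* d := d) refl cube) (⇓⇒≃ coefC-⇓)

    weierstrass-den≉0 : ¬ den (weierstrass x) ≈ 0#
    weierstrass-den≉0 = integral (integral (integral (integral (integral xd≉0 xd≉0) xd≉0)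
      (integral (integral (den≉0 coefA-⇓) xd≉0) xd≉0)) (integral (den≉0 coefB-⇓) xd≉0)) (den≉0 coefC-⇓)

    affine-points : y *F y ≈F weierstrass x →
      (x ⇓ - A × y ⇓ 0#) ⊎ (x ⇓ 𝟚 × (y ⇓ 𝟚 * b ⊎ y ⇓ - (𝟚 * b)))
    affine-points h = convert (Points.classify lead-b lead-b-1 lead-1-b xd≉0 yd≉0
      (cross-eq (≃-trans {y *F y} {weierstrass x} {cubic X xd // cube} weierstrass-den≉0 (≈F⇒≃ {y *F y} {weierstrass x} h) weierstrass≃)))
      where
      convert : (X ≈ 0# × yn ≈ 0#) ⊎ (X ≈ b * xd × (yn ≈ 𝟚 * b * yd ⊎ yn ≈ - (𝟚 * b * yd))) →
        (x ⇓ - A × y ⇓ 0#) ⊎ (x ⇓ 𝟚 × (y ⇓ 𝟚 * b ⊎ y ⇓ - (𝟚 * b)))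
      convert (inj₁ (X≈0 , yn≈0)) = inj₁
        ( value xd≉0 (x-y≈0⇒x≈y (trans (solve 3 (λ n A d → n :- (:- A) :* d := n :+ A :* d) refl xn A xd) X≈0))
        , value yd≉0 yn≈0)
      convert (inj₂ (X≈bxd , ys)) = inj₂
        ( value xd≉0 (combine 𝟙 X≈bxd (solve 3 (λ a n d →
            n :- :2 :* d := :1 :* (n :+ (:4 :* a :- :1) :* d :- (:4 :* a :+ :1) :* d)) refl a xn xd))
        , sign ys)
        where
        sign : (yn ≈ 𝟚 * b * yd ⊎ yn ≈ - (𝟚 * b * yd)) → y ⇓ 𝟚 * b ⊎ y ⇓ - (𝟚 * b)
        sign (inj₁ h) = inj₁ (value yd≉0 h)
        sign (inj₂ h) = inj₂ (value yd≉0 (trans h (solve 2 (λ t d → :- (t :* d) := (:- t) :* d) refl (𝟚 * b) yd)))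

  -- The group law on P₀ and its multiples

  chord : Fn → Fn → Fn → Fn → Point
  chord l x₁ y₁ x₂ = aff x₃ (negF (y₁ +F (l *F (x₃ -F x₁))))
    where x₃ = (l *F l) -F coefA -F x₁ -F x₂

  -- `chord` repeats the local function `third` of `addP`, so that a branch of `addP` becomes an
  -- equation under a hypothesis and no test on fractions has to be computed.
  addP-chord : ∀ {x₁ y₁ x₂ y₂} → ¬ x₁ ≈F x₂ →
    addP (aff x₁ y₁) (aff x₂ y₂) ≡ chord ((y₂ -F y₁) /F (x₂ -F x₁)) x₁ y₁ x₂
  addP-chord {x₁} {y₁} {x₂} {y₂} x₁≉x₂ with x₁ ≈F? x₂
  ... | yes x₁≈x₂ = ⊥-elim (x₁≉x₂ x₁≈x₂)
  ... | no  _     = ≡.refl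

  addP-tangent : ∀ {x₁ y₁ x₂ y₂} → x₁ ≈F x₂ → ¬ (y₁ +F y₂) ≈F constF 0ℚ →
    addP (aff x₁ y₁) (aff x₂ y₂)
      ≡ chord (((nat 3 *F x₁ *F x₁) +F (nat 2 *F coefA *F x₁) +F coefB) /F (nat 2 *F y₁)) x₁ y₁ x₂
  addP-tangent {x₁} {y₁} {x₂} {y₂} x₁≈x₂ y₁≉-y₂ with x₁ ≈F? x₂
  ... | no  x₁≉x₂ = ⊥-elim (x₁≉x₂ x₁≈x₂)
  ... | yes _ with (y₁ +F y₂) ≈F? constF 0ℚ
  ...   | yes y₁≈-y₂ = ⊥-elim (y₁≉-y₂ y₁≈-y₂)
  ...   | no  _      = ≡.refl

  addP-opposite : ∀ {x₁ y₁ x₂ y₂} → x₁ ≈F x₂ → (y₁ +F y₂) ≈F constF 0ℚ → addP (aff x₁ y₁) (aff x₂ y₂) ≡ O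
  addP-opposite {x₁} {y₁} {x₂} {y₂} x₁≈x₂ y₁≈-y₂ with x₁ ≈F? x₂
  ... | no  x₁≉x₂ = ⊥-elim (x₁≉x₂ x₁≈x₂)
  ... | yes _ with (y₁ +F y₂) ≈F? constF 0ℚ
  ...   | yes _      = ≡.refl
  ...   | no  y₁≉-y₂ = ⊥-elim (y₁≉-y₂ y₁≈-y₂)

  data Coordinates (p q : Poly) : Point → Set where
    coordinates : ∀ {x y} → x ⇓ p → y ⇓ q → Coordinates p q (aff x y)

  chord-coordinates : ∀ {l x₁ y₁ x₂ s p₁ q₁ p₂ p₃ q₃} → l ⇓ s → x₁ ⇓ p₁ → y₁ ⇓ q₁ → x₂ ⇓ p₂ →
    s * s - A - p₁ - p₂ ≈ p₃ → - (q₁ + s * (p₃ - p₁)) ≈ q₃ → Coordinates p₃ q₃ (chord l x₁ y₁ x₂)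
  chord-coordinates ls x₁p y₁q x₂p x₃≈ y₃≈ = coordinates x₃⇓ (⇓-resp y₃≈ (⇓-neg (⇓-+ y₁q (⇓-* ls (⇓-- x₃⇓ x₁p)))))
    where x₃⇓ = ⇓-resp x₃≈ (⇓-- (⇓-- (⇓-- (⇓-* ls ls) coefA-⇓) x₁p) x₂p)

  -- The slope is supplied as a polynomial `s` and verified by multiplying out.
  chord-+ : ∀ {P Q p₁ q₁ p₂ q₂ p₃ q₃} s → Coordinates p₁ q₁ P → Coordinates p₂ q₂ Q →
    ¬ p₂ - p₁ ≈ 0# → q₂ - q₁ ≈ s * (p₂ - p₁) →
    s * s - A - p₁ - p₂ ≈ p₃ → - (q₁ + s * (p₃ - p₁)) ≈ q₃ → Coordinates p₃ q₃ (addP P Q)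
  chord-+ {p₃ = p₃} {q₃} s (coordinates {x₁} {y₁} x₁⇓ y₁⇓) (coordinates {x₂} {y₂} x₂⇓ y₂⇓) p₂≉p₁ slope x₃≈ y₃≈ =
    ≡.subst (Coordinates p₃ q₃) (≡.sym (addP-chord {x₁} {y₁} {x₂} {y₂} (λ h → p₂≉p₁ (x≈y⇒x-y≈0 (sym (≈F⇒≈ x₁⇓ x₂⇓ h))))))
      (chord-coordinates (⇓-/ s p₂≉p₁ slope (⇓-- y₂⇓ y₁⇓) (⇓-- x₂⇓ x₁⇓)) x₁⇓ y₁⇓ x₂⇓ x₃≈ y₃≈)

  tangent-+ : ∀ {P Q p q p₃ q₃} s → Coordinates p q P → Coordinates p q Q →
    ¬ q ≈ 0# → 𝟛 * p * p + 𝟚 * A * p + B ≈ s * (𝟚 * q) →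
    s * s - A - p - p ≈ p₃ → - (q + s * (p₃ - p)) ≈ q₃ → Coordinates p₃ q₃ (addP P Q)
  tangent-+ {p = p} {q} {p₃} {q₃} s (coordinates {x₁} {y₁} x₁⇓ y₁⇓) (coordinates {x₂} {y₂} x₂⇓ y₂⇓) q≉0 slope x₃≈ y₃≈ =
    ≡.subst (Coordinates p₃ q₃) (≡.sym (addP-tangent {x₁} {y₁} {x₂} {y₂} (⇓⇒≈F refl x₁⇓ x₂⇓)
        (λ h → 2q≉0 (trans (solve 1 (λ q → :2 :* q := q :+ q) refl q)
          (trans (≈F⇒≈ (⇓-+ y₁⇓ y₂⇓) (const-⇓ 0ℚ) h) 0-homo)))))
      (chord-coordinates
        (⇓-/ s 2q≉0 slope
          (⇓-+ (⇓-+ (⇓-* (⇓-* (const-⇓ (+ 3 ℚ./ 1)) x₁⇓) x₁⇓) (⇓-* (⇓-* (const-⇓ (+ 2 ℚ./ 1)) coefA-⇓) x₁⇓)) coefB-⇓)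
          (⇓-* (const-⇓ (+ 2 ℚ./ 1)) y₁⇓))
        x₁⇓ y₁⇓ x₂⇓ x₃≈ y₃≈)
    where
    2q≉0 : ¬ 𝟚 * q ≈ 0#
    2q≉0 = integral 𝟚≉0 q≉0

  opposite-+ : ∀ {P Q p q} → Coordinates p q P → Coordinates p (- q) Q → addP P Q ≡ O
  opposite-+ {q = q} (coordinates {x₁} {y₁} x₁⇓ y₁⇓) (coordinates {x₂} {y₂} x₂⇓ y₂⇓) =
    addP-opposite {x₁} {y₁} {x₂} {y₂} (⇓⇒≈F refl x₁⇓ x₂⇓)
    (⇓⇒≈F (trans (CommutativeRing.-‿inverseʳ ring q) (sym 0-homo)) (⇓-+ y₁⇓ y₂⇓) (const-⇓ 0ℚ))

  coordinates-≈P : ∀ {x y p q P} → x ⇓ p → y ⇓ q → Coordinates p q P → aff x y ≈P P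
  coordinates-≈P x⇓ y⇓ (coordinates x′⇓ y′⇓) = ⇓⇒≈F refl x⇓ x′⇓ , ⇓⇒≈F refl y⇓ y′⇓

  coordinates-≉O : ∀ {p q P} → Coordinates p q P → ¬ P ≈P O
  coordinates-≉O (coordinates _ _) ()

  module _ {P} (1P : Coordinates 𝟚 (𝟚 * b) P) where

    multiple₁ : Coordinates 𝟚 (𝟚 * b) (mulP 1 P)
    multiple₁ = identityʳ 1P
      where
      identityʳ : ∀ {p q P} → Coordinates p q P → Coordinates p q (addP P O)
      identityʳ c@(coordinates _ _) = c

    multiple₂ : Coordinates (- A) 0# (mulP 2 P)
    -- The tangent slope at (2, 2b) is (12 + 4A + 16a)/(4b) = 8b/(4b) = 2.
    multiple₂ = tangent-+ 𝟚 1P multiple₁ (integral {𝟚} {b} 𝟚≉0 (lead≉0 lead-b))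
      (solve 1 (λ a → :3 :* :2 :* :2 :+ :2 :* (:4 :* a :- :1) :* :2 :+ :16 :* a
        := :2 :* (:2 :* (:2 :* (:4 :* a :+ :1)))) refl a)
      (solve 1 (λ A → :2 :* :2 :- A :- :2 :- :2 := :- A) refl A)
      (trans (solve 1 (λ a → :- (:2 :* (:4 :* a :+ :1) :+ :2 :* (:- (:4 :* a :- :1) :- :2)) := con 0ℚ) refl a) 0-homo)

    multiple₃ : Coordinates 𝟚 (- (𝟚 * b)) (mulP 3 P)
    -- The tangent at P passes through 2P, which is its own negative; so the chord is that tangent,
    -- of slope 2, and its third intersection is P itself.
    multiple₃ = chord-+ 𝟚 1P multiple₂
      (λ h → lead≉0 lead-b (trans
        (solve 1 (λ a → :4 :* a :+ :1 := :- (:- (:4 :* a :- :1) :- :2)) refl a) (-‿cong h)))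
      (solve 1 (λ a → :- (:2 :* (:4 :* a :+ :1)) := :2 :* (:- (:4 :* a :- :1) :- :2)) refl a)
      (solve 1 (λ A → :2 :* :2 :- A :- :2 :- (:- A) := :2) refl A)
      (solve 1 (λ t → :- (t :+ :2 :* (:2 :- :2)) := :- t) refl (𝟚 * b))

    multiple₄ : mulP 4 P ≡ O
    multiple₄ = opposite-+ 1P multiple₃

  P₀-coordinates : Coordinates 𝟚 (𝟚 * b) P₀
  P₀-coordinates = coordinates (const-⇓ (+ 2 ℚ./ 1)) (⇓-resp
    (solve 1 (λ a → :8 :* a :+ :2 := :2 :* (:4 :* a :+ :1)) refl a)
    (⇓-+ (⇓-* (const-⇓ (+ 8 ℚ./ 1)) varA-⇓) (const-⇓ (+ 2 ℚ./ 1))))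

  ⇓⇒valid : ∀ {f p} → f ⇓ p → Valid f
  ⇓⇒valid f⇓ z = den≉0 f⇓ (zero⇒≈ z)

  coordinates-on-curve : ∀ {P p q} → Coordinates p q P → q * q ≈ p * p * p + A * p * p + B * p + C → OnE P
  coordinates-on-curve (coordinates x⇓ y⇓) h = ⇓⇒valid x⇓ , ⇓⇒valid y⇓ ,
    ⇓⇒≈F h (⇓-* y⇓ y⇓) (⇓-+ (⇓-+ (⇓-+ (⇓-* (⇓-* x⇓ x⇓) x⇓) (⇓-* (⇓-* coefA-⇓ x⇓) x⇓)) (⇓-* coefB-⇓ x⇓)) coefC-⇓)

  P₀-on-curve : OnE P₀
  P₀-on-curve = coordinates-on-curve P₀-coordinates
      (solve 1 (λ a → :2 :* (:4 :* a :+ :1) :* (:2 :* (:4 :* a :+ :1))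
        := :2 :* :2 :* :2 :+ (:4 :* a :- :1) :* :2 :* :2 :+ :16 :* a :* :2
           :+ (:64 :* a :* a :- :16 :* a)) refl a)

  multiple-of-P₀ : (Q : Point) → OnE Q → Σ ℕ (λ n → (n < 4) × (Q ≈P mulP n P₀))
  multiple-of-P₀ O _ = 0 , s≤s z≤n , tt
  multiple-of-P₀ (aff (xn // xd) (yn // yd)) (vx , vy , h) =
    select (affine-points (λ z → vx (≈⇒zero xd z)) (λ z → vy (≈⇒zero yd z)) h)
    where
    x y : Fn
    x = xn // xd
    y = yn // yd
    select : (x ⇓ - A × y ⇓ 0#) ⊎ (x ⇓ 𝟚 × (y ⇓ 𝟚 * b ⊎ y ⇓ - (𝟚 * b))) →
             Σ ℕ (λ n → (n < 4) × (aff x y ≈P mulP n P₀))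
    select (inj₁ (x⇓ , y⇓))      = 2 , s≤s (s≤s (s≤s z≤n)) , coordinates-≈P x⇓ y⇓ (multiple₂ P₀-coordinates)
    select (inj₂ (x⇓ , inj₁ y⇓)) = 1 , s≤s (s≤s z≤n) , coordinates-≈P x⇓ y⇓ (multiple₁ P₀-coordinates)
    select (inj₂ (x⇓ , inj₂ y⇓)) = 3 , s≤s (s≤s (s≤s (s≤s z≤n))) , coordinates-≈P x⇓ y⇓ (multiple₃ P₀-coordinates)

open Fractions

-- The order is exactly 4 because 2P₀ differs from O. That every point is among the four multiples
-- gives rank 0 and the torsion group at once.
theorem3p2 : OnE P₀
    × (mulP 4 P₀ ≈P O)
    × ¬ (mulP 2 P₀ ≈P O)
    × ((Q : Point) → OnE Q → Σ ℕ (λ n → (n < 4) × (Q ≈P mulP n P₀)))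
theorem3p2 =
    P₀-on-curve
  , ≡.subst (_≈P O) (≡.sym (multiple₄ P₀-coordinates)) tt
  , coordinates-≉O (multiple₂ P₀-coordinates)
  , multiple-of-P₀
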